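{- Let $n>1$, let $V=\{v\in\{ -1,1\}^n : v_1=1\}$, and for a real number $M$ let $K_M=\{(x_1,\dots,x_n)\in\mathbb{R}^n : x_i\le M \text{ for all } i\in[n]\}$. Consider the balancing game $G(V,K_M)$. Then: (1) If $n$ is odd, Chooser has a winning strategy if and only if $M\ge 2^{n-2}-\frac12\binom{n-1}{(n-1)/2}$. (2) If $n$ is even and not a power of $2$, Chooser has a winning strategy if and only if $M\ge 2^{n-2}-\frac12\binom{n-1}{n/2}$. (3) If $n$ is a power of $2$, Chooser has a winning strategy if and only if $M\ge 2^{n-2}-\frac12\binom{n-1}{n/2}+\frac12$. In each case the critical value of $M$ is $2^{n-2}(1-O(n^{ -1/2}))$.
   Context: Given a set $V\subset\mathbb{R}^n$ and a convex set $K\subseteq\mathbb{R}^n$, the balancing game $G(V,K)$ is a perfect information game between two players, Pusher and Chooser, proceeding through a sequence of points $z_0=0,z_1,z_2,\dots\in\mathbb{R}^n$: in round $k$ Pusher offers a vector $v_k\in V$, Chooser selects $\varepsilon_k\in\{ -1,1\}$, and the next position is $z_{k+1}=z_k+\varepsilon_k v_k$. Pusher wins if he can make $z_k\notin K$ for some $k$; Chooser wins if she can keep $z_k\in K$ for all $k$.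
   Formalization: The bound M ranges over rational numbers instead of real numbers; since all positions of the game are integer vectors and the critical values are rational, the real case follows easily. -}

module Defs where

open import Data.Nat.DivMod as ℕ using (_/_)
open import Data.Nat using (ℕ; zero; suc; _∸_; _^_)
open import Data.Nat.Combinatorics using (_C_)
open import Data.Integer as ℤ using (ℤ; +_)
open import Data.Rational as ℚ using (ℚ; ½)
open import Data.Sign using (Sign)
open import Data.Fin using (Fin)
open import Data.List using (List; map; upTo)
open import Data.Fin using (toℕ)
open import Data.Product using (_×_; ∃-syntax; Σ-syntax)
open import Data.Sum using (_⊎_)
open import Relation.Binary.PropositionalEquality using (_≡_)

-- Points of ℤⁿ (all positions of the game with V ⊆ {-1,1}ⁿ are integral).
Point : ℕ → Set
Point n = Fin n → ℤ

origin : ∀ {n} → Point n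
origin _ = + 0

signℤ : Sign → ℤ
signℤ Sign.+ = + 1
signℤ Sign.- = ℤ.- (+ 1)

step : ∀ {n} → Point n → Sign → Point n → Point n
step z ε v i = z i ℤ.+ signℤ ε ℤ.* v i

-- A Chooser strategy: given the history of Pusher's previous offers
-- [v_0, …, v_{k-1}] and the current offer v_k, choose ε_k.
ChooserStrategy : ℕ → Set
ChooserStrategy n = List (Point n) → Point n → Sign

history : ∀ {n} → (ℕ → Point n) → ℕ → List (Point n)
history p k = map p (upTo k)

position : ∀ {n} → ChooserStrategy n → (ℕ → Point n) → ℕ → Point n
position σ p zero    = origin
position σ p (suc k) = step (position σ p k) (σ (history p k) (p k)) (p k)

-- Chooser has a winning strategy in G(V,K): some strategy keeps z_k ∈ K for
-- all k against every sequence of offers from V (Pusher's adaptivity is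
-- irrelevant since Chooser's strategy is deterministic).
ChooserWins : ∀ {n} → (Point n → Set) → (Point n → Set) → Set
ChooserWins {n} V K =
  Σ[ σ ∈ ChooserStrategy n ] ((p : ℕ → Point n) → (∀ k → V (p k)) → ∀ k → K (position σ p k))

-- V = { v ∈ {-1,1}ⁿ : v₁ = 1 }  (v₁ is the coordinate with index 0)
Vset : (n : ℕ) → Point n → Set
Vset n v = (∀ i → v i ≡ + 1 ⊎ v i ≡ ℤ.- (+ 1)) × (∀ i → toℕ i ≡ 0 → v i ≡ + 1)

toℚ : ℤ → ℚ
toℚ z = z ℚ./ 1

KM : (n : ℕ) → ℚ → Point n → Set
KM n M x = ∀ i → toℚ (x i) ℚ.≤ M

ℕtoℚ : ℕ → ℚ
ℕtoℚ m = toℚ (+ m)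

critOdd : ℕ → ℚ
critOdd n = ℕtoℚ (2 ^ (n ∸ 2)) ℚ.- ½ ℚ.* ℕtoℚ ((n ∸ 1) C ((n ∸ 1) ℕ./ 2))

critEven : ℕ → ℚ
critEven n = ℕtoℚ (2 ^ (n ∸ 2)) ℚ.- ½ ℚ.* ℕtoℚ ((n ∸ 1) C (n ℕ./ 2))

critPow2 : ℕ → ℚ
critPow2 n = critEven n ℚ.+ ½

IsPowerOf2 : ℕ → Set
IsPowerOf2 n = ∃[ k ] n ≡ 2 ^ k

-- "t(n) = 2^{n-2}(1 - O(n^{-1/2}))" with constant C, squared:
-- n · (2^{n-2} - t(n))² ≤ C · (2^{n-2})²
AsymBound : ℕ → ℕ → ℚ → Set
AsymBound C n t =
  ℕtoℚ n ℚ.* ((ℕtoℚ (2 ^ (n ∸ 2)) ℚ.- t) ℚ.* (ℕtoℚ (2 ^ (n ∸ 2)) ℚ.- t))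
    ℚ.≤ ℕtoℚ C ℚ.* (ℕtoℚ (2 ^ (n ∸ 2)) ℚ.* ℕtoℚ (2 ^ (n ∸ 2)))

{-# OPTIONS --safe #-}
-- Identify v ∈ {-1,1}ⁿ with a subset of [n]. Chooser fixes one set from every complementary pair, with at
-- most n/2 elements, and answers the offers of each pair alternately, adding the fixed set first. The i-th
-- coordinate then never exceeds the number of fixed sets containing i, and exchanging sets of size n/2 makes
-- these numbers as equal as parity allows. Pusher considers, among all positions he can force, the maximisers of
-- linear functionals. When the functional moves from (nearly) the sum of coordinates towards the i-th coordinate,
-- it becomes orthogonal to each light set containing i, and offering that set raises the i-th coordinate of the
-- maximiser. Averaging over i shows that some coordinate reaches the average degree of a selection of light sets,
-- which is 2ⁿ⁻² − ½ C(n-1, ⌊n/2⌋). Rounding up this half-integer depends on the parity of the binomial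
-- coefficient, which is odd exactly for powers of two.
module Submission where

open import Defs
open import Algebra.Bundles using (AbelianGroup)
import Algebra.Properties.CommutativeMonoid.Sum as MonoidSum
import Algebra.Properties.Group as Group
import Algebra.Properties.Semiring.Sum as SemiringSum
open import Data.Bool using (Bool; true; false; not; if_then_else_; _xor_; _∧_)
open import Data.Bool.Properties using (not-involutive; not-¬; ∧-identityʳ) renaming (_≟_ to _≟ᵇ_)
open import Data.Empty using (⊥; ⊥-elim)
open import Data.Fin using (Fin; zero; suc; toℕ)
open import Data.Fin.Properties using (any?) renaming (_≟_ to _≟ᶠ_)
open import Data.List using (List; []; _∷_; foldl; _∷ʳ_; applyUpTo)
open import Data.List.Properties using (foldl-∷ʳ; map-upTo; applyUpTo-∷ʳ)
open import Data.Nat as ℕ hiding (_≤_)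
open import Data.Nat.Combinatorics using (nCk+nC[k+1]≡[n+1]C[k+1]; k>n⇒nCk≡0; nC1≡n; nCk≡nC[n∸k])
  renaming (_C_ to _choose_)
open import Data.Nat.DivMod using (+-distrib-/-∣ʳ; m*n/n≡m; m*n%n≡0; [m+kn]%n≡m%n)
open import Data.Nat.Divisibility using (divides)
open import Data.Nat.Properties
open import Data.Nat.Tactic.RingSolver using (solve-∀)
open import Data.Parity as ℙ using (0ℙ; 1ℙ)
import Data.Parity.Properties as ℙ
open import Data.Product using (_×_; _,_; ∃-syntax; proj₁; proj₂)
open import Data.Rational using (ℚ; _≤_)
open import Data.Sign using (Sign)
open import Data.Sum using (_⊎_; inj₁; inj₂)
open import Data.Vec using (Vec; []; _∷_; lookup; map; updateAt; head; tabulate; replicate)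
open import Data.Vec.Properties using (≡-dec; lookup-map; lookup∘updateAt; lookup∘updateAt′; lookup∘tabulate)
open import Function using (_∘_)
open import Function.Bundles using (_⇔_; mk⇔)
open import Relation.Binary.Definitions using (tri<; tri≈; tri>)
open import Relation.Binary.PropositionalEquality
open import Relation.Nullary using (¬_; Dec; yes; no; contradiction)
open import Relation.Nullary.Decidable using (decidable-stable; ⌊_⌋)

-- Both players have to round the same half-integer. With b = C(n-1, ⌊n/2⌋), which covers all three
-- cases because ⌊n/2⌋ = (n-1)/2 for odd n, the critical value is the integer c determined by 2ⁿ⁻¹ ≤
-- 2c + b ≤ 2ⁿ⁻¹ + 1. Chooser's side uses the first inequality and Pusher's side the second. For
-- Chooser, rounding up is harmless because all degrees share one parity, so moves of two units
-- never overshoot. For Pusher, assuming that every forced coordinate is at most c - 1 gives, after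
-- doubling and summing over the coordinates, a surplus of 2n against an allowance of n; the
-- remaining n pays for perturbing the functional. The perturbation cannot be avoided: the plain sum
-- of coordinates vanishes on balanced vectors and takes equal values on many others, whereas each
-- step of the sweep can use only one offer. Reachability of a position under an arbitrary strategy
-- is not decidable, so maximisers exist only under double negation. This suffices, since only
-- contradictions and decidable inequalities are drawn from them.

module Σℕ where
  open MonoidSum +-0-commutativeMonoid public
  open SemiringSum +-*-semiring public using (*-distribˡ-sum; *-distribʳ-sum)

open ≡-Reasoning

-- Sums over the cube and binomial coefficients

Cube : ℕ → Set
Cube = Vec Bool

compl : ∀ {n} → Cube n → Cube n
compl = map not

⟦_⟧ : Bool → ℕ
⟦ true  ⟧ = 1
⟦ false ⟧ = 0

∑ : ∀ {n} → (Cube n → ℕ) → ℕ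
∑ {zero}  f = f []
∑ {suc n} f = ∑ (f ∘ (true ∷_)) + ∑ (f ∘ (false ∷_))

∑-cong : ∀ {n} {f g : Cube n → ℕ} → (∀ v → f v ≡ g v) → ∑ f ≡ ∑ g
∑-cong {zero}  h = h []
∑-cong {suc n} h = cong₂ _+_ (∑-cong (h ∘ (true ∷_))) (∑-cong (h ∘ (false ∷_)))

∑-mono : ∀ {n} {f g : Cube n → ℕ} → (∀ v → f v ℕ.≤ g v) → ∑ f ℕ.≤ ∑ g
∑-mono {zero}  h = h []
∑-mono {suc n} h = +-mono-≤ (∑-mono (h ∘ (true ∷_))) (∑-mono (h ∘ (false ∷_)))

∑-+ : ∀ {n} (f g : Cube n → ℕ) → ∑ (λ v → f v + g v) ≡ ∑ f + ∑ g
∑-+ {zero}  f g = refl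
∑-+ {suc n} f g = begin
  ∑ (λ v → f (true ∷ v) + g (true ∷ v)) + ∑ (λ v → f (false ∷ v) + g (false ∷ v))
    ≡⟨ cong₂ _+_ (∑-+ (f ∘ (true ∷_)) (g ∘ (true ∷_))) (∑-+ (f ∘ (false ∷_)) (g ∘ (false ∷_))) ⟩
  (∑ (f ∘ (true ∷_)) + ∑ (g ∘ (true ∷_))) + (∑ (f ∘ (false ∷_)) + ∑ (g ∘ (false ∷_)))
    ≡⟨ interchange (∑ (f ∘ (true ∷_))) (∑ (g ∘ (true ∷_))) (∑ (f ∘ (false ∷_))) (∑ (g ∘ (false ∷_))) ⟩
  ∑ f + ∑ g ∎
  where
  interchange : ∀ a b c d → (a + b) + (c + d) ≡ (a + c) + (b + d)
  interchange = solve-∀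

∑-*ˡ : ∀ {n} k (f : Cube n → ℕ) → ∑ (λ v → k * f v) ≡ k * ∑ f
∑-*ˡ {zero}  k f = refl
∑-*ˡ {suc n} k f = trans
  (cong₂ _+_ (∑-*ˡ k (f ∘ (true ∷_))) (∑-*ˡ k (f ∘ (false ∷_))))
  (sym (*-distribˡ-+ k (∑ (f ∘ (true ∷_))) (∑ (f ∘ (false ∷_)))))

∑-1 : ∀ n → ∑ {n} (λ _ → 1) ≡ 2 ^ n
∑-1 zero    = refl
∑-1 (suc n) = cong₂ _+_ (∑-1 n) (trans (∑-1 n) (sym (+-identityʳ (2 ^ n))))

∑-const : ∀ n k → ∑ {n} (λ _ → k) ≡ k * 2 ^ n
∑-const n k = begin
  ∑ {n} (λ _ → k)      ≡⟨ ∑-cong {n} (λ _ → sym (*-identityʳ k)) ⟩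
  ∑ {n} (λ _ → k * 1)  ≡⟨ ∑-*ˡ {n} k (λ _ → 1) ⟩
  k * ∑ {n} (λ _ → 1)  ≡⟨ cong (k *_) (∑-1 n) ⟩
  k * 2 ^ n            ∎

∑-compl : ∀ {n} (f : Cube n → ℕ) → ∑ (f ∘ compl) ≡ ∑ f
∑-compl {zero}  f = refl
∑-compl {suc n} f = trans
  (cong₂ _+_ (∑-compl (f ∘ (false ∷_))) (∑-compl (f ∘ (true ∷_))))
  (+-comm (∑ (f ∘ (false ∷_))) (∑ (f ∘ (true ∷_))))

flip : ∀ {n} → Fin n → Cube n → Cube n
flip i v = updateAt v i not

∑-flip : ∀ {n} i (f : Cube n → ℕ) → ∑ (f ∘ flip i) ≡ ∑ f
∑-flip zero    f = +-comm (∑ (f ∘ (false ∷_))) (∑ (f ∘ (true ∷_)))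
∑-flip (suc i) f = cong₂ _+_ (∑-flip i (f ∘ (true ∷_))) (∑-flip i (f ∘ (false ∷_)))

-- The additive form replaces a difference of sums. It serves both to edit a family at one vector
-- and to count what changes at one crossing.
∑-differ : ∀ {n} {f g : Cube n → ℕ} a → (∀ v → v ≢ a → f v ≡ g v) → ∑ f + g a ≡ ∑ g + f a
∑-differ {zero}  {f} {g} [] h = +-comm (f []) (g [])
∑-differ {suc n} {f} {g} (b ∷ a) h = glue b
  (λ v v≢a → h (b ∷ v) λ { refl → v≢a refl })
  (λ v → h (not b ∷ v) (not-b∷ b))
  where
  not-b∷ : ∀ b {v} → not b ∷ v ≢ b ∷ a
  not-b∷ true  ()
  not-b∷ false ()

  first : ∀ x y z w k l → k ≡ l → x + y ≡ z + w → (x + k) + y ≡ (z + l) + w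
  first x y z w k .k refl e = begin
    (x + k) + y ≡⟨ swap x k y ⟩
    (x + y) + k ≡⟨ cong (_+ k) e ⟩
    (z + w) + k ≡⟨ swap z w k ⟩
    (z + k) + w ∎
    where
    swap : ∀ x k y → (x + k) + y ≡ (x + y) + k
    swap = solve-∀

  second : ∀ x y z w k l → k ≡ l → x + y ≡ z + w → (k + x) + y ≡ (l + z) + w
  second x y z w k .k refl e = begin
    (k + x) + y ≡⟨ +-assoc k x y ⟩
    k + (x + y) ≡⟨ cong (k +_) e ⟩
    k + (z + w) ≡⟨ +-assoc k z w ⟨
    (k + z) + w ∎

  glue : ∀ b → (∀ v → v ≢ a → f (b ∷ v) ≡ g (b ∷ v)) → (∀ v → f (not b ∷ v) ≡ g (not b ∷ v)) →
         ∑ f + g (b ∷ a) ≡ ∑ g + f (b ∷ a)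
  glue true  h₁ h₂ = first  (∑ (f ∘ (true ∷_))) (g (true ∷ a)) (∑ (g ∘ (true ∷_))) (f (true ∷ a))
    (∑ (f ∘ (false ∷_))) (∑ (g ∘ (false ∷_))) (∑-cong h₂) (∑-differ {n} {f ∘ (true ∷_)} {g ∘ (true ∷_)} a h₁)
  glue false h₁ h₂ = second (∑ (f ∘ (false ∷_))) (g (false ∷ a)) (∑ (g ∘ (false ∷_))) (f (false ∷ a))
    (∑ (f ∘ (true ∷_))) (∑ (g ∘ (true ∷_))) (∑-cong h₂) (∑-differ {n} {f ∘ (false ∷_)} {g ∘ (false ∷_)} a h₁)

∑-<⇒∃ : ∀ {n} (f g : Cube n → ℕ) → ∑ f < ∑ g → ∃[ v ] f v < g v
∑-<⇒∃ {zero}  f g h = [] , h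
∑-<⇒∃ {suc n} f g h with ∑ (f ∘ (true ∷_)) <? ∑ (g ∘ (true ∷_))
... | yes h₁ = let (v , p) = ∑-<⇒∃ (f ∘ (true ∷_)) (g ∘ (true ∷_)) h₁ in true ∷ v , p
... | no ¬h₁ with ∑ (f ∘ (false ∷_)) <? ∑ (g ∘ (false ∷_))
...   | yes h₂ = let (v , p) = ∑-<⇒∃ (f ∘ (false ∷_)) (g ∘ (false ∷_)) h₂ in false ∷ v , p
...   | no ¬h₂ = contradiction h (≤⇒≯ (+-mono-≤ (≮⇒≥ ¬h₁) (≮⇒≥ ¬h₂)))

∑-∑Fin : ∀ {n m} (f : Cube n → Fin m → ℕ) → Σℕ.sum (λ i → ∑ (λ v → f v i)) ≡ ∑ (λ v → Σℕ.sum (f v))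
∑-∑Fin {zero}  f = refl
∑-∑Fin {suc n} f = trans
  (Σℕ.∑-distrib-+ (λ i → ∑ (λ v → f (true ∷ v) i)) (λ i → ∑ (λ v → f (false ∷ v) i)))
  (cong₂ _+_ (∑-∑Fin (f ∘ (true ∷_))) (∑-∑Fin (f ∘ (false ∷_))))

ones zeros : ∀ {n} → Cube n → ℕ
ones []      = 0
ones (b ∷ v) = ⟦ b ⟧ + ones v
zeros v = ones (compl v)

∑Fin-lookup : ∀ {n} (v : Cube n) → Σℕ.sum (λ i → ⟦ lookup v i ⟧) ≡ ones v
∑Fin-lookup []      = refl
∑Fin-lookup (b ∷ v) = cong (⟦ b ⟧ +_) (∑Fin-lookup v)

ones+zeros : ∀ {n} (v : Cube n) → ones v + zeros v ≡ n
ones+zeros []          = refl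
ones+zeros (true ∷ v)  = cong suc (ones+zeros v)
ones+zeros (false ∷ v) = trans (+-suc (ones v) (zeros v)) (cong suc (ones+zeros v))

∑-ones : ∀ n k → ∑ {n} (λ v → ⟦ ones v ≡ᵇ k ⟧) ≡ n choose k
∑-ones zero    zero    = refl
∑-ones zero    (suc k) = sym (k>n⇒nCk≡0 {0} {suc k} z<s)
∑-ones (suc n) zero    = cong₂ _+_ (trans (∑-const n 0) refl) (∑-ones n 0)
∑-ones (suc n) (suc k) = trans (cong₂ _+_ (∑-ones n k) (∑-ones n (suc k))) (nCk+nC[k+1]≡[n+1]C[k+1] n k)

compl-involutive : ∀ {n} (v : Cube n) → compl (compl v) ≡ v
compl-involutive []      = refl
compl-involutive (b ∷ v) = cong₂ _∷_ (not-involutive b) (compl-involutive v)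

-- Total imbalance of the cube, as the mean displacement of a random walk

imbalance : ∀ {n} → Cube n → ℕ
imbalance v = ∣ ones v - zeros v ∣

imbalance-compl : ∀ {n} (v : Cube n) → imbalance (compl v) ≡ imbalance v
imbalance-compl v = trans
  (cong (λ w → ∣ zeros v - ones w ∣) (compl-involutive v))
  (∣-∣-comm (zeros v) (ones v))

-- The second difference of the absolute value vanishes away from the origin: a step of the simple
-- random walk increases the mean distance from 0 only when it starts at 0.
∣-∣-step : ∀ x y → ∣ suc x - y ∣ + ∣ x - suc y ∣ ≡ 2 * (∣ x - y ∣ + ⟦ x ≡ᵇ y ⟧)
∣-∣-step zero    zero    = refl
∣-∣-step zero    (suc y) = lemma y
  where
  lemma : ∀ y → y + suc (suc y) ≡ 2 * (suc y + 0)
  lemma = solve-∀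
∣-∣-step (suc x) zero    rewrite ∣-∣-identityʳ x = lemma x
  where
  lemma : ∀ x → suc (suc x) + x ≡ 2 * (suc x + 0)
  lemma = solve-∀
∣-∣-step (suc x) (suc y) = ∣-∣-step x y

∑-imbalance-step : ∀ n → ∑ {suc n} imbalance ≡ 2 * (∑ {n} imbalance + ∑ {n} (λ v → ⟦ ones v ≡ᵇ zeros v ⟧))
∑-imbalance-step n = begin
  ∑ {n} (λ v → ∣ suc (ones v) - zeros v ∣) + ∑ {n} (λ v → ∣ ones v - suc (zeros v) ∣)
    ≡⟨ ∑-+ {n} (λ v → ∣ suc (ones v) - zeros v ∣) (λ v → ∣ ones v - suc (zeros v) ∣) ⟨
  ∑ {n} (λ v → ∣ suc (ones v) - zeros v ∣ + ∣ ones v - suc (zeros v) ∣)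
    ≡⟨ ∑-cong {n} (λ v → ∣-∣-step (ones v) (zeros v)) ⟩
  ∑ {n} (λ v → 2 * (imbalance v + ⟦ ones v ≡ᵇ zeros v ⟧))
    ≡⟨ ∑-*ˡ {n} 2 _ ⟩
  2 * ∑ {n} (λ v → imbalance v + ⟦ ones v ≡ᵇ zeros v ⟧)
    ≡⟨ cong (2 *_) (∑-+ {n} _ _) ⟩
  2 * (∑ {n} imbalance + ∑ {n} (λ v → ⟦ ones v ≡ᵇ zeros v ⟧)) ∎

balanced-even : ∀ x y m → x + y ≡ m + m → (x ≡ᵇ y) ≡ (x ≡ᵇ m)
balanced-even zero    y       zero    e = cong (zero ≡ᵇ_) e
balanced-even zero    (suc y) (suc m) e = refl
balanced-even (suc x) zero    zero    e = refl
balanced-even (suc x) zero    (suc m) e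
  rewrite suc-injective (trans (sym (+-identityʳ (suc x))) e) | +-comm m (suc m) = sym (≡ᵇ-suc+ m m)
  where
  ≡ᵇ-suc+ : ∀ k m → (suc k + m ≡ᵇ m) ≡ false
  ≡ᵇ-suc+ k zero = refl
  ≡ᵇ-suc+ k (suc m) rewrite +-suc k m = ≡ᵇ-suc+ k m
balanced-even (suc x) (suc y) zero    ()
balanced-even (suc x) (suc y) (suc m) e = balanced-even x y m
  (suc-injective (suc-injective (trans (trans (cong suc (sym (+-suc x y))) e) (cong suc (+-suc m m)))))

balanced-odd : ∀ x y m → x + y ≡ suc (m + m) → (x ≡ᵇ y) ≡ false
balanced-odd zero    (suc y) m e = refl
balanced-odd (suc x) zero    m e = refl
balanced-odd (suc x) (suc y) zero e = contradiction (trans (sym (+-suc x y)) (suc-injective e)) λ ()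
balanced-odd (suc x) (suc y) (suc m) e = balanced-odd x y m
  (suc-injective (suc-injective (trans (trans (cong suc (sym (+-suc x y))) e) (cong (λ k → suc (suc k)) (+-suc m m)))))

∑-balanced-even : ∀ m → ∑ {m + m} (λ v → ⟦ ones v ≡ᵇ zeros v ⟧) ≡ (m + m) choose m
∑-balanced-even m = trans
  (∑-cong (λ v → cong ⟦_⟧ (balanced-even (ones v) (zeros v) m (ones+zeros v))))
  (∑-ones (m + m) m)

∑-balanced-odd : ∀ m → ∑ {suc (m + m)} (λ v → ⟦ ones v ≡ᵇ zeros v ⟧) ≡ 0
∑-balanced-odd m = trans
  (∑-cong (λ v → cong ⟦_⟧ (balanced-odd (ones v) (zeros v) m (ones+zeros v))))
  (∑-const (suc (m + m)) 0)

-- The absorption identity, by Pascal's rule. It gives the ratio of neighbouring central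
-- coefficients, needed both for the closed form of the imbalance and for the growth estimate.
C-absorb : ∀ n k → suc k * (suc n choose suc k) ≡ suc n * (n choose k)
C-absorb zero    zero    = refl
C-absorb zero    (suc k)
  rewrite k>n⇒nCk≡0 {1} {suc (suc k)} (s<s z<s) | k>n⇒nCk≡0 {0} {suc k} z<s = *-zeroʳ k
C-absorb (suc n) zero    = trans (*-identityˡ _) (trans (nC1≡n (suc (suc n))) (sym (*-identityʳ (suc (suc n)))))
C-absorb (suc n) (suc k) = begin
  suc (suc k) * (suc (suc n) choose suc (suc k))
    ≡⟨ cong (suc (suc k) *_) (nCk+nC[k+1]≡[n+1]C[k+1] (suc n) (suc k)) ⟨
  suc (suc k) * (x + y)
    ≡⟨ split k x y ⟩
  suc k * x + suc (suc k) * y + x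
    ≡⟨ cong₂ (λ p q → p + q + x) (C-absorb n k) (C-absorb n (suc k)) ⟩
  suc n * (n choose k) + suc n * (n choose suc k) + x
    ≡⟨ cong (_+ x) (*-distribˡ-+ (suc n) (n choose k) (n choose suc k)) ⟨
  suc n * (n choose k + n choose suc k) + x
    ≡⟨ cong (λ z → suc n * z + x) (nCk+nC[k+1]≡[n+1]C[k+1] n k) ⟩
  suc n * x + x
    ≡⟨ +-comm (suc n * x) x ⟩
  suc (suc n) * x ∎
  where
  x = suc n choose suc k
  y = suc n choose suc (suc k)
  split : ∀ k x y → suc (suc k) * (x + y) ≡ suc k * x + suc (suc k) * y + x
  split = solve-∀

central-step : ∀ m → suc m * (suc (m + m) choose suc m) ≡ suc (m + m) * ((m + m) choose m)
central-step m = C-absorb (m + m) m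

C-odd-sym : ∀ m → suc (m + m) choose m ≡ suc (m + m) choose suc m
C-odd-sym m = trans
  (nCk≡nC[n∸k] {m} {suc (m + m)} (≤-trans (m≤m+n m m) (n≤1+n (m + m))))
  (cong (suc (m + m) choose_) (trans (cong (_∸ m) (sym (+-suc m m))) (m+n∸m≡n m (suc m))))

C-even-double : ∀ m → (suc m + suc m) choose suc m ≡ 2 * (suc (m + m) choose suc m)
C-even-double m = begin
  suc (m + suc m) choose suc m                  ≡⟨ cong (λ z → suc z choose suc m) (+-suc m m) ⟩
  suc (suc (m + m)) choose suc m                ≡⟨ nCk+nC[k+1]≡[n+1]C[k+1] (suc (m + m)) m ⟨
  suc (m + m) choose m + suc (m + m) choose suc m    ≡⟨ cong (_+ (suc (m + m) choose suc m)) (C-odd-sym m) ⟩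
  suc (m + m) choose suc m + suc (m + m) choose suc m
    ≡⟨ cong ((suc (m + m) choose suc m) +_) (+-identityʳ (suc (m + m) choose suc m)) ⟨
  2 * (suc (m + m) choose suc m) ∎

mutual
  -- Balanced vectors exist in even dimensions only, so the recursion gains a term at every other
  -- step and each parity has its own closed form.
  ∑-imbalance-odd : ∀ m → ∑ {suc (m + m)} imbalance ≡ 2 * (suc (m + m) * ((m + m) choose m))
  ∑-imbalance-odd m = begin
    ∑ {suc (m + m)} imbalance
      ≡⟨ ∑-imbalance-step (m + m) ⟩
    2 * (∑ {m + m} imbalance + ∑ {m + m} (λ v → ⟦ ones v ≡ᵇ zeros v ⟧))
      ≡⟨ cong₂ (λ x y → 2 * (x + y)) (∑-imbalance-even m) (∑-balanced-even m) ⟩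
    2 * ((m + m) * ((m + m) choose m) + (m + m) choose m)
      ≡⟨ cong (2 *_) (+-comm ((m + m) * ((m + m) choose m)) ((m + m) choose m)) ⟩
    2 * (suc (m + m) * ((m + m) choose m)) ∎

  ∑-imbalance-even : ∀ m → ∑ {m + m} imbalance ≡ (m + m) * ((m + m) choose m)
  ∑-imbalance-even zero    = refl
  ∑-imbalance-even (suc m) = begin
    ∑ {suc m + suc m} imbalance
      ≡⟨ cong (λ k → ∑ {suc k} imbalance) (+-suc m m) ⟩
    ∑ {suc (suc (m + m))} imbalance
      ≡⟨ ∑-imbalance-step (suc (m + m)) ⟩
    2 * (∑ {suc (m + m)} imbalance + ∑ {suc (m + m)} (λ v → ⟦ ones v ≡ᵇ zeros v ⟧))
      ≡⟨ cong₂ (λ x y → 2 * (x + y)) (∑-imbalance-odd m) (∑-balanced-odd m) ⟩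
    2 * (2 * (suc (m + m) * ((m + m) choose m)) + 0)
      ≡⟨ cong (λ x → 2 * (2 * x + 0)) (central-step m) ⟨
    2 * (2 * (suc m * (suc (m + m) choose suc m)) + 0)
      ≡⟨ regroup m (suc (m + m) choose suc m) ⟩
    (suc m + suc m) * (2 * (suc (m + m) choose suc m))
      ≡⟨ cong ((suc m + suc m) *_) (C-even-double m) ⟨
    (suc m + suc m) * ((suc m + suc m) choose suc m) ∎
    where
    regroup : ∀ m x → 2 * (2 * (suc m * x) + 0) ≡ (suc m + suc m) * (2 * x)
    regroup = solve-∀

halve : ∀ n → ∃[ m ] (n ≡ m + m ⊎ n ≡ suc (m + m))
halve zero    = 0 , inj₁ refl
halve (suc n) with halve n
... | m , inj₁ refl = m , inj₂ refl
... | m , inj₂ refl = suc m , inj₁ (cong suc (sym (+-suc m m)))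

m+m≡m*2 : ∀ m → m + m ≡ m * 2
m+m≡m*2 = solve-∀

[m+m]/2 : ∀ m → (m + m) / 2 ≡ m
[m+m]/2 m = trans (cong (_/ 2) (m+m≡m*2 m)) (m*n/n≡m m 2)

[1+m+m]/2 : ∀ m → suc (m + m) / 2 ≡ m
[1+m+m]/2 m = trans (+-distrib-/-∣ʳ 1 (divides m (m+m≡m*2 m))) ([m+m]/2 m)

[m+m]%2 : ∀ m → (m + m) % 2 ≡ 0
[m+m]%2 m = trans (cong (_% 2) (m+m≡m*2 m)) (m*n%n≡0 m 2)

[1+m+m]%2 : ∀ m → suc (m + m) % 2 ≡ 1
[1+m+m]%2 m = trans (cong (λ k → suc k % 2) (m+m≡m*2 m)) ([m+kn]%n≡m%n 1 m 2)

-- For positive `n` the total imbalance is `2 * (n * midBinomial n)` whatever the parity of `n`;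
-- this is how the binomial coefficient enters the critical value.
midBinomial : ℕ → ℕ
midBinomial n = (n ∸ 1) choose (n / 2)

midBinomial-odd : ∀ m → midBinomial (suc (m + m)) ≡ (m + m) choose m
midBinomial-odd m = cong ((m + m) choose_) ([1+m+m]/2 m)

midBinomial-even : ∀ m → midBinomial (suc m + suc m) ≡ suc (m + m) choose suc m
midBinomial-even m = cong₂ _choose_ (+-suc m m) ([m+m]/2 (suc m))

∑-imbalance : ∀ n → ∑ {suc n} imbalance ≡ 2 * (suc n * midBinomial (suc n))
∑-imbalance n with halve n
... | m , inj₁ refl = trans (∑-imbalance-odd m) (cong (λ b → 2 * (suc (m + m) * b)) (sym (midBinomial-odd m)))
... | m , inj₂ refl = begin
  ∑ {suc (suc (m + m))} imbalance          ≡⟨ cong (λ k → ∑ {suc k} imbalance) (+-suc m m) ⟨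
  ∑ {suc m + suc m} imbalance              ≡⟨ ∑-imbalance-even (suc m) ⟩
  (suc m + suc m) * ((suc m + suc m) choose suc m)
    ≡⟨ cong ((suc m + suc m) *_) (C-even-double m) ⟩
  (suc m + suc m) * (2 * (suc (m + m) choose suc m))
    ≡⟨ regroup (suc m + suc m) (suc (m + m) choose suc m) ⟩
  2 * ((suc m + suc m) * (suc (m + m) choose suc m))
    ≡⟨ cong (λ b → 2 * ((suc m + suc m) * b)) (midBinomial-even m) ⟨
  2 * ((suc m + suc m) * midBinomial (suc m + suc m))
    ≡⟨ cong (λ k → 2 * (suc k * midBinomial (suc k))) (+-suc m m) ⟩
  2 * (suc (suc (m + m)) * midBinomial (suc (suc (m + m)))) ∎
  where
  regroup : ∀ x y → x * (2 * y) ≡ 2 * (x * y)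
  regroup = solve-∀

-- Binomial coefficients modulo 2

mutual
  -- Lucas's theorem modulo 2 for the last binary digit: dropping it from both arguments keeps the
  -- parity, unless the lower digit is 1 and the upper one 0. Pascal's rule links the four digit
  -- patterns, hence the mutual recursion.
  parity-C-even-even : ∀ a b → parity ((a + a) choose (b + b)) ≡ parity (a choose b)
  parity-C-even-even a       zero    = refl
  parity-C-even-even zero    (suc b) = refl
  parity-C-even-even (suc a) (suc b) = begin
    parity ((suc a + suc a) choose (suc b + suc b))
      ≡⟨ cong₂ (λ x y → parity (suc x choose suc y)) (+-suc a a) (+-suc b b) ⟩
    parity (suc (suc (a + a)) choose suc (suc (b + b)))
      ≡⟨ cong parity (nCk+nC[k+1]≡[n+1]C[k+1] (suc (a + a)) (suc (b + b))) ⟨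
    parity (suc (a + a) choose suc (b + b) + suc (a + a) choose suc (suc (b + b)))
      ≡⟨ ℙ.+-homo-+ (suc (a + a) choose suc (b + b)) _ ⟩
    parity (suc (a + a) choose suc (b + b)) ℙ.+ parity (suc (a + a) choose suc (suc (b + b)))
      ≡⟨ cong (λ y → parity (suc (a + a) choose suc (b + b)) ℙ.+ parity (suc (a + a) choose suc y)) (+-suc b b) ⟨
    parity (suc (a + a) choose suc (b + b)) ℙ.+ parity (suc (a + a) choose (suc b + suc b))
      ≡⟨ cong₂ ℙ._+_ (parity-C-odd-odd a b) (parity-C-odd-even a (suc b)) ⟩
    parity (a choose b) ℙ.+ parity (a choose suc b)
      ≡⟨ ℙ.+-homo-+ (a choose b) _ ⟨
    parity (a choose b + a choose suc b)
      ≡⟨ cong parity (nCk+nC[k+1]≡[n+1]C[k+1] a b) ⟩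
    parity (suc a choose suc b) ∎

  parity-C-even-odd : ∀ a b → parity ((a + a) choose suc (b + b)) ≡ 0ℙ
  parity-C-even-odd zero    b = refl
  parity-C-even-odd (suc a) b = begin
    parity ((suc a + suc a) choose suc (b + b))
      ≡⟨ cong (λ x → parity (suc x choose suc (b + b))) (+-suc a a) ⟩
    parity (suc (suc (a + a)) choose suc (b + b))
      ≡⟨ cong parity (nCk+nC[k+1]≡[n+1]C[k+1] (suc (a + a)) (b + b)) ⟨
    parity (suc (a + a) choose (b + b) + suc (a + a) choose suc (b + b))
      ≡⟨ ℙ.+-homo-+ (suc (a + a) choose (b + b)) _ ⟩
    parity (suc (a + a) choose (b + b)) ℙ.+ parity (suc (a + a) choose suc (b + b))
      ≡⟨ cong₂ ℙ._+_ (parity-C-odd-even a b) (parity-C-odd-odd a b) ⟩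
    parity (a choose b) ℙ.+ parity (a choose b)
      ≡⟨ ℙ.p+p≡0ℙ (parity (a choose b)) ⟩
    0ℙ ∎

  parity-C-odd-even : ∀ a b → parity (suc (a + a) choose (b + b)) ≡ parity (a choose b)
  parity-C-odd-even a zero    = refl
  parity-C-odd-even a (suc b) = begin
    parity (suc (a + a) choose (suc b + suc b))
      ≡⟨ cong parity (nCk+nC[k+1]≡[n+1]C[k+1] (a + a) (b + suc b)) ⟨
    parity ((a + a) choose (b + suc b) + (a + a) choose (suc b + suc b))
      ≡⟨ ℙ.+-homo-+ ((a + a) choose (b + suc b)) _ ⟩
    parity ((a + a) choose (b + suc b)) ℙ.+ parity ((a + a) choose (suc b + suc b))
      ≡⟨ cong₂ ℙ._+_
          (trans (cong (λ y → parity ((a + a) choose y)) (+-suc b b)) (parity-C-even-odd a b))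
          (parity-C-even-even a (suc b)) ⟩
    parity (a choose suc b) ∎

  parity-C-odd-odd : ∀ a b → parity (suc (a + a) choose suc (b + b)) ≡ parity (a choose b)
  parity-C-odd-odd a b = begin
    parity (suc (a + a) choose suc (b + b))
      ≡⟨ cong parity (nCk+nC[k+1]≡[n+1]C[k+1] (a + a) (b + b)) ⟨
    parity ((a + a) choose (b + b) + (a + a) choose suc (b + b))
      ≡⟨ ℙ.+-homo-+ ((a + a) choose (b + b)) _ ⟩
    parity ((a + a) choose (b + b)) ℙ.+ parity ((a + a) choose suc (b + b))
      ≡⟨ cong₂ ℙ._+_ (parity-C-even-even a b) (parity-C-even-odd a b) ⟩
    parity (a choose b) ℙ.+ 0ℙ
      ≡⟨ ℙ.+-identityʳ _ ⟩
    parity (a choose b) ∎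

parity-central : ∀ m → parity ((suc m + suc m) choose suc m) ≡ 0ℙ
parity-central m = begin
  parity ((suc m + suc m) choose suc m) ≡⟨ cong parity (C-even-double m) ⟩
  parity (x + (x + 0))             ≡⟨ cong (λ y → parity (x + y)) (+-identityʳ x) ⟩
  parity (x + x)                   ≡⟨ ℙ.+-homo-+ x x ⟩
  parity x ℙ.+ parity x          ≡⟨ ℙ.p+p≡0ℙ (parity x) ⟩
  0ℙ ∎
  where x = suc (m + m) choose suc m

-- For m = 2b + 1 this halves m + 1 in the coefficient C(2m+1, m+1).
parity-descent : ∀ b → parity (suc (suc (b + b) + suc (b + b)) choose suc (suc (b + b))) ≡ parity (suc (b + b) choose suc b)
parity-descent b = trans
  (cong (λ y → parity (suc (suc (b + b) + suc (b + b)) choose suc y)) (sym (+-suc b b)))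
  (parity-C-odd-even (suc (b + b)) (suc b))

parity-mid-pow2 : ∀ k m → suc m ≡ 2 ^ k → parity (suc (m + m) choose suc m) ≡ 1ℙ
parity-mid-pow2 zero    zero e = refl
parity-mid-pow2 (suc k) m    e with 2 ^ k in eq | m^n>0 2 k
-- Since `2 ^ k` is `suc b`, the equation forces `m` to be `suc (b + b)`, where the descent applies.
... | suc b | _ with refl ← trans (suc-injective e) (trans (cong (b +_) (+-identityʳ (suc b))) (+-suc b b)) =
  trans (parity-descent b) (parity-mid-pow2 k b (sym eq))

-- Halving m + 1 while it is even ends either at 1, when it was a power of two, or at a larger odd
-- number. There m is even and positive, and the digit step leads to C(m, m/2), which is even.
parity-mid : ∀ fuel m → m < fuel → parity (suc (m + m) choose suc m) ≡ 0ℙ ⊎ IsPowerOf2 (suc m)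
parity-mid (suc fuel) m (s≤s m≤) with halve m
... | zero  , inj₁ refl = inj₂ (0 , refl)
... | suc b , inj₁ refl = inj₁ (trans (parity-C-odd-odd (suc b + suc b) (suc b)) (parity-central b))
... | b     , inj₂ refl with parity-mid fuel b (≤-trans (s≤s (m≤m+n b b)) m≤)
...   | inj₁ p       = inj₁ (trans (parity-descent b) p)
...   | inj₂ (k , e) = inj₂ (suc k , trans (double b) (cong (2 *_) e))
  where
  double : ∀ b → suc (suc (b + b)) ≡ 2 * suc b
  double = solve-∀

midBinomial-parity-odd : ∀ n → 1 < n → n % 2 ≡ 1 → parity (midBinomial n) ≡ 0ℙ
midBinomial-parity-odd n 1<n odd with halve n
... | m     , inj₁ refl = contradiction (trans (sym ([m+m]%2 m)) odd) λ ()
... | zero  , inj₂ refl = contradiction 1<n λ { (s≤s ()) }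
... | suc m , inj₂ refl = trans (cong parity (midBinomial-odd (suc m))) (parity-central m)

midBinomial-parity-even : ∀ n → 1 < n → n % 2 ≡ 0 → ¬ IsPowerOf2 n → parity (midBinomial n) ≡ 0ℙ
midBinomial-parity-even n 1<n even ¬pow with halve n
... | m     , inj₂ refl = contradiction (trans (sym even) ([1+m+m]%2 m)) λ ()
... | zero  , inj₁ refl = contradiction 1<n λ ()
... | suc m , inj₁ refl with parity-mid (suc m) m ≤-refl
...   | inj₁ p       = trans (cong parity (midBinomial-even m)) p
...   | inj₂ (k , e) = contradiction (suc k , cong₂ _+_ e (trans e (sym (+-identityʳ (2 ^ k))))) ¬pow

midBinomial-parity-pow2 : ∀ n → 1 < n → IsPowerOf2 n → parity (midBinomial n) ≡ 1ℙ
midBinomial-parity-pow2 n 1<n (zero  , refl) = contradiction 1<n λ { (s≤s ()) }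
midBinomial-parity-pow2 n 1<n (suc k , refl) with 2 ^ k in eq | m^n>0 2 k
... | suc m | _ = begin
  parity (midBinomial (suc m + (suc m + 0))) ≡⟨ cong (λ x → parity (midBinomial (suc m + x))) (+-identityʳ (suc m)) ⟩
  parity (midBinomial (suc m + suc m))       ≡⟨ cong parity (midBinomial-even m) ⟩
  parity (suc (m + m) choose suc m)               ≡⟨ parity-mid-pow2 k m (sym eq) ⟩
  1ℙ ∎

parity-0 : ∀ n → parity n ≡ 0ℙ → ∃[ h ] n ≡ h + h
parity-0 zero          e = 0 , refl
parity-0 (suc (suc n)) e = let (h , p) = parity-0 n e in suc h , trans (cong (λ x → suc (suc x)) p) (cong suc (sym (+-suc h h)))

parity-1 : ∀ n → parity n ≡ 1ℙ → ∃[ h ] n ≡ suc (h + h)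
parity-1 (suc zero)    e = 0 , refl
parity-1 (suc (suc n)) e = let (h , p) = parity-1 n e in suc h , trans (cong (λ x → suc (suc x)) p) (cong (λ x → suc (suc x)) (sym (+-suc h h)))

-- Growth of the central binomial coefficient

central-bound : ∀ m → suc (m + m) * (((m + m) choose m) * ((m + m) choose m)) ℕ.≤ 16 ^ m
central-bound zero    = ≤-refl
central-bound (suc m) = *-cancelˡ-≤ (suc m * suc m) chain
  where
  module R = ≤-Reasoning
  Q = suc (m + m) choose suc m
  P = (m + m) choose m
  P⁺ = (suc m + suc m) choose suc m
  s = suc m + suc m

  expand : ∀ m s Q → suc m * suc m * (suc s * ((2 * Q) * (2 * Q))) ≡ 4 * suc s * ((suc m * Q) * (suc m * Q))
  expand = solve-∀

  collect : ∀ s u P → 4 * suc s * ((u * P) * (u * P)) ≡ 4 * suc s * u * (u * (P * P))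
  collect = solve-∀

  -- The factor 2m + 1 is chosen to make the induction close: the ratio of consecutive left sides is
  -- 4(2m+3)(2m+1)/(m+1)², and its numerator falls short of 16(m+1)² by just 4.
  quad : ∀ m → 4 * suc (suc m + suc m) * suc (m + m) + 4 ≡ suc m * suc m * 16
  quad = solve-∀

  chain : suc m * suc m * (suc s * (P⁺ * P⁺)) ℕ.≤ suc m * suc m * 16 ^ suc m
  chain = R.begin
    suc m * suc m * (suc s * (P⁺ * P⁺))
      R.≡⟨ cong (λ x → suc m * suc m * (suc s * (x * x))) (C-even-double m) ⟩
    suc m * suc m * (suc s * ((2 * Q) * (2 * Q)))
      R.≡⟨ expand m s Q ⟩
    4 * suc s * ((suc m * Q) * (suc m * Q))
      R.≡⟨ cong (λ x → 4 * suc s * (x * x)) (central-step m) ⟩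
    4 * suc s * ((suc (m + m) * P) * (suc (m + m) * P))
      R.≡⟨ collect s (suc (m + m)) P ⟩
    4 * suc s * suc (m + m) * (suc (m + m) * (P * P))
      R.≤⟨ *-mono-≤ (≤-trans (m≤m+n (4 * suc s * suc (m + m)) 4) (≤-reflexive (quad m))) (central-bound m) ⟩
    suc m * suc m * 16 * 16 ^ m
      R.≡⟨ *-assoc (suc m * suc m) 16 (16 ^ m) ⟩
    suc m * suc m * 16 ^ suc m R.∎

16^m≡4^[m+m] : ∀ m → 16 ^ m ≡ 4 ^ (m + m)
16^m≡4^[m+m] m = trans (^-*-assoc 4 2 m) (cong (4 ^_) (cong (m +_) (+-identityʳ m)))

-- In an odd dimension the coefficient is central. In an even dimension it is half of a central one,
-- and the dimension is raised by one to match the factor of the central bound.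
midBinomial-bound : ∀ n → suc n * (midBinomial (suc n) * midBinomial (suc n)) ℕ.≤ 4 ^ n
midBinomial-bound n with halve n
... | m , inj₁ refl = subst₂ (λ b p → suc (m + m) * (b * b) ℕ.≤ p) (sym (midBinomial-odd m)) (16^m≡4^[m+m] m) (central-bound m)
... | m , inj₂ refl = subst (λ b → suc (suc (m + m)) * (b * b) ℕ.≤ 4 ^ suc (m + m)) mid≡ (*-cancelˡ-≤ 4 chain)
  where
  module R = ≤-Reasoning
  Q = suc (m + m) choose suc m

  mid≡ : Q ≡ midBinomial (suc (suc (m + m)))
  mid≡ = trans (sym (midBinomial-even m)) (cong (λ k → midBinomial (suc k)) (+-suc m m))

  square : ∀ n Q → 4 * (n * (Q * Q)) ≡ n * ((2 * Q) * (2 * Q))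
  square = solve-∀

  chain : 4 * (suc (suc (m + m)) * (Q * Q)) ℕ.≤ 4 * 4 ^ suc (m + m)
  chain = R.begin
    4 * (suc (suc (m + m)) * (Q * Q))       R.≡⟨ square (suc (suc (m + m))) Q ⟩
    suc (suc (m + m)) * ((2 * Q) * (2 * Q)) R.≡⟨ cong (λ x → suc (suc (m + m)) * (x * x)) (C-even-double m) ⟨
    suc (suc (m + m)) * (P⁺ * P⁺)           R.≤⟨ *-monoˡ-≤ (P⁺ * P⁺) (n≤1+n (suc (suc (m + m)))) ⟩
    suc (suc (suc (m + m))) * (P⁺ * P⁺)     R.≡⟨ cong (λ k → suc (suc k) * (P⁺ * P⁺)) (+-suc m m) ⟨
    suc (suc m + suc m) * (P⁺ * P⁺)         R.≤⟨ central-bound (suc m) ⟩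
    16 ^ suc m                              R.≡⟨ 16^m≡4^[m+m] (suc m) ⟩
    4 ^ (suc m + suc m)                     R.≡⟨ cong (λ k → 4 ^ suc k) (+-suc m m) ⟩
    4 * 4 ^ suc (m + m) R.∎
    where P⁺ = (suc m + suc m) choose suc m

-- Selections from the pairs ±v and their degrees

_≟ᶜ_ : ∀ {n} (u v : Cube n) → Dec (u ≡ v)
_≟ᶜ_ = ≡-dec _≟ᵇ_

Family : ℕ → Set
Family n = Cube n → Bool

Selection : ∀ {n} → Family n → Set
Selection F = ∀ v → F (compl v) ≡ not (F v)

Light : ∀ {n} → Family n → Set
Light F = ∀ v → F v ≡ true → ones v ℕ.≤ zeros v

degree : ∀ {n} → Family n → Fin n → ℕ
degree F i = ∑ (λ v → ⟦ F v ⟧ * ⟦ lookup v i ⟧)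

-- Every complementary pair contributes its value twice to the full sum and once to the selected
-- one.
∑-selection : ∀ {n} {F : Family n} → Selection F → (h : Cube n → ℕ) → (∀ v → h (compl v) ≡ h v) →
              2 * ∑ (λ v → ⟦ F v ⟧ * h v) ≡ ∑ h
∑-selection {n} {F} sel h sym-h = begin
  2 * ∑ (λ v → ⟦ F v ⟧ * h v)
    ≡⟨ cong (X +_) (+-identityʳ X) ⟩
  X + X
    ≡⟨ cong (X +_) (∑-compl (λ v → ⟦ F v ⟧ * h v)) ⟨
  X + ∑ (λ v → ⟦ F (compl v) ⟧ * h (compl v))
    ≡⟨ ∑-+ {n} (λ v → ⟦ F v ⟧ * h v) _ ⟨
  ∑ (λ v → ⟦ F v ⟧ * h v + ⟦ F (compl v) ⟧ * h (compl v))
    ≡⟨ ∑-cong {n} (λ v → cong₂ (λ b x → ⟦ F v ⟧ * h v + ⟦ b ⟧ * x) (sel v) (sym-h v)) ⟩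
  ∑ (λ v → ⟦ F v ⟧ * h v + ⟦ not (F v) ⟧ * h v)
    ≡⟨ ∑-cong {n} (λ v → partition (F v) (h v)) ⟩
  ∑ h ∎
  where
  X = ∑ (λ v → ⟦ F v ⟧ * h v)

  partition : ∀ b x → ⟦ b ⟧ * x + ⟦ not b ⟧ * x ≡ x
  partition true  x = trans (+-identityʳ (x + 0)) (+-identityʳ x)
  partition false x = +-identityʳ x

∑Fin-degree : ∀ {n} (F : Family n) → Σℕ.sum (degree F) ≡ ∑ (λ v → ⟦ F v ⟧ * ones v)
∑Fin-degree {n} F = trans (∑-∑Fin (λ v i → ⟦ F v ⟧ * ⟦ lookup v i ⟧))
  (∑-cong {n} (λ v → trans (sym (Σℕ.*-distribˡ-sum ⟦ F v ⟧ (λ i → ⟦ lookup v i ⟧))) (cong (⟦ F v ⟧ *_) (∑Fin-lookup v))))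

light-imbalance : ∀ x y → x ℕ.≤ y → 2 * x + ∣ x - y ∣ ≡ x + y
light-imbalance x y x≤y = begin
  2 * x + ∣ x - y ∣ ≡⟨ cong (2 * x +_) (m≤n⇒∣m-n∣≡n∸m x≤y) ⟩
  2 * x + (y ∸ x)   ≡⟨ regroup x (y ∸ x) ⟩
  x + (x + (y ∸ x)) ≡⟨ cong (x +_) (m+[n∸m]≡n x≤y) ⟩
  x + y ∎
  where
  regroup : ∀ x z → 2 * x + z ≡ x + (x + z)
  regroup = solve-∀

-- A light vector has size (n - imbalance)/2, and a selection sees exactly half of the total
-- imbalance. So the average degree is the same for all light selections, which is why Chooser's
-- bound and Pusher's bound can meet although their selections differ.
∑Fin-degree-light : ∀ {p} {F : Family (suc p)} → Selection F → Light F →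
  2 * Σℕ.sum (degree F) + suc p * midBinomial (suc p) ≡ suc p * 2 ^ p
∑Fin-degree-light {p} {F} sel light = *-cancelˡ-≡ _ _ 2 (begin
  2 * (2 * Σℕ.sum (degree F) + suc p * b)
    ≡⟨ cong (λ s → 2 * (2 * s + suc p * b)) (∑Fin-degree F) ⟩
  2 * (2 * S + suc p * b)
    ≡⟨ *-distribˡ-+ 2 (2 * S) (suc p * b) ⟩
  2 * (2 * S) + 2 * (suc p * b)
    ≡⟨ cong (2 * (2 * S) +_) (∑-imbalance p) ⟨
  2 * (2 * S) + ∑ {suc p} imbalance
    ≡⟨ cong (2 * (2 * S) +_) (∑-selection sel imbalance imbalance-compl) ⟨
  2 * (2 * S) + 2 * I
    ≡⟨ *-distribˡ-+ 2 (2 * S) I ⟨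
  2 * (2 * S + I)
    ≡⟨ cong (λ x → 2 * (x + I)) (∑-*ˡ {suc p} 2 (λ v → ⟦ F v ⟧ * ones v)) ⟨
  2 * (∑ (λ v → 2 * (⟦ F v ⟧ * ones v)) + I)
    ≡⟨ cong (2 *_) (∑-+ {suc p} (λ v → 2 * (⟦ F v ⟧ * ones v)) (λ v → ⟦ F v ⟧ * imbalance v)) ⟨
  2 * ∑ (λ v → 2 * (⟦ F v ⟧ * ones v) + ⟦ F v ⟧ * imbalance v)
    ≡⟨ cong (2 *_) (∑-cong {suc p} pointwise) ⟩
  2 * ∑ {suc p} (λ v → ⟦ F v ⟧ * suc p)
    ≡⟨ ∑-selection sel (λ _ → suc p) (λ _ → refl) ⟩
  ∑ {suc p} (λ _ → suc p)
    ≡⟨ ∑-const (suc p) (suc p) ⟩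
  suc p * (2 * 2 ^ p)
    ≡⟨ swap (suc p) (2 ^ p) ⟩
  2 * (suc p * 2 ^ p) ∎)
  where
  b = midBinomial (suc p)
  S = ∑ (λ v → ⟦ F v ⟧ * ones v)
  I = ∑ (λ v → ⟦ F v ⟧ * imbalance v)

  swap : ∀ x y → x * (2 * y) ≡ 2 * (x * y)
  swap = solve-∀

  pointwise : ∀ v → 2 * (⟦ F v ⟧ * ones v) + ⟦ F v ⟧ * imbalance v ≡ ⟦ F v ⟧ * suc p
  pointwise v with F v in eq
  ... | false = refl
  ... | true  = begin
    2 * (ones v + 0) + (imbalance v + 0)
      ≡⟨ cong₂ (λ x y → 2 * x + y) (+-identityʳ (ones v)) (+-identityʳ (imbalance v)) ⟩
    2 * ones v + imbalance v
      ≡⟨ light-imbalance (ones v) (zeros v) (light v eq) ⟩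
    ones v + zeros v
      ≡⟨ ones+zeros v ⟩
    suc p
      ≡⟨ +-identityʳ (suc p) ⟨
    suc p + 0 ∎

lookup-compl : ∀ {n} (v : Cube n) k → lookup (compl v) k ≡ not (lookup v k)
lookup-compl v k = lookup-map k not v

lookup-flip : ∀ {n} i (v : Cube n) → lookup (flip i v) i ≡ not (lookup v i)
lookup-flip i v = lookup∘updateAt i v

lookup-flip′ : ∀ {n} {i k : Fin n} → k ≢ i → (v : Cube n) → lookup (flip i v) k ≡ lookup v k
lookup-flip′ {i = i} {k} k≢i v = lookup∘updateAt′ k i k≢i v

-- Modulo 2 the two degrees differ by the number of members separating `i` from `j`. The separating
-- vectors form half of the cube and are closed under complement, so 2ⁿ⁻² of them are selected,
-- which is even once n ≥ 3.
degree-parity : ∀ {n} {F : Family n} → 3 ℕ.≤ n → Selection F → ∀ i j → parity (degree F i) ≡ parity (degree F j)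
degree-parity {n} {F} 3≤n sel i j with i ≟ᶠ j
... | yes refl = refl
... | no  i≢j  = parity-eq (degree F i) (degree F j) (2 ^ (n ∸ 3) + B) (begin
  degree F i + degree F j
    ≡⟨ ∑-+ {n} (λ v → ⟦ F v ⟧ * ⟦ lookup v i ⟧) (λ v → ⟦ F v ⟧ * ⟦ lookup v j ⟧) ⟨
  ∑ (λ v → ⟦ F v ⟧ * ⟦ lookup v i ⟧ + ⟦ F v ⟧ * ⟦ lookup v j ⟧)
    ≡⟨ ∑-cong {n} (λ v → split ⟦ F v ⟧ (lookup v i) (lookup v j)) ⟩
  ∑ (λ v → ⟦ F v ⟧ * d v + 2 * (⟦ F v ⟧ * ⟦ lookup v i ∧ lookup v j ⟧))
    ≡⟨ ∑-+ {n} (λ v → ⟦ F v ⟧ * d v) (λ v → 2 * (⟦ F v ⟧ * ⟦ lookup v i ∧ lookup v j ⟧)) ⟩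
  ∑ (λ v → ⟦ F v ⟧ * d v) + ∑ (λ v → 2 * (⟦ F v ⟧ * ⟦ lookup v i ∧ lookup v j ⟧))
    ≡⟨ cong₂ _+_ E≡ (∑-*ˡ {n} 2 (λ v → ⟦ F v ⟧ * ⟦ lookup v i ∧ lookup v j ⟧)) ⟩
  2 * 2 ^ (n ∸ 3) + 2 * B
    ≡⟨ *-distribˡ-+ 2 (2 ^ (n ∸ 3)) B ⟨
  2 * (2 ^ (n ∸ 3) + B) ∎)
  where
  d : Cube n → ℕ
  d v = ⟦ lookup v i xor lookup v j ⟧
  B = ∑ (λ v → ⟦ F v ⟧ * ⟦ lookup v i ∧ lookup v j ⟧)

  split-bits : ∀ a b → ⟦ a ⟧ + ⟦ b ⟧ ≡ ⟦ a xor b ⟧ + 2 * ⟦ a ∧ b ⟧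
  split-bits true  true  = refl
  split-bits true  false = refl
  split-bits false true  = refl
  split-bits false false = refl

  distrib : ∀ f x y → f * (x + 2 * y) ≡ f * x + 2 * (f * y)
  distrib = solve-∀

  split : ∀ f a b → f * ⟦ a ⟧ + f * ⟦ b ⟧ ≡ f * ⟦ a xor b ⟧ + 2 * (f * ⟦ a ∧ b ⟧)
  split f a b = trans (sym (*-distribˡ-+ f ⟦ a ⟧ ⟦ b ⟧))
    (trans (cong (f *_) (split-bits a b)) (distrib f ⟦ a xor b ⟧ ⟦ a ∧ b ⟧))

  xor-not-not : ∀ a b → not a xor not b ≡ a xor b
  xor-not-not true  true  = refl
  xor-not-not true  false = refl
  xor-not-not false true  = refl
  xor-not-not false false = refl

  d-compl : ∀ v → d (compl v) ≡ d v
  d-compl v = cong ⟦_⟧ (trans (cong₂ _xor_ (lookup-compl v i) (lookup-compl v j)) (xor-not-not (lookup v i) (lookup v j)))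

  xor-not : ∀ a b → ⟦ a xor b ⟧ + ⟦ not a xor b ⟧ ≡ 1
  xor-not true  true  = refl
  xor-not true  false = refl
  xor-not false true  = refl
  xor-not false false = refl

  ∑d : 2 * ∑ d ≡ 2 ^ n
  ∑d = begin
    2 * ∑ d                   ≡⟨ cong (∑ d +_) (+-identityʳ (∑ d)) ⟩
    ∑ d + ∑ d                 ≡⟨ cong (∑ d +_) (∑-flip i d) ⟨
    ∑ d + ∑ (d ∘ flip i)      ≡⟨ ∑-+ {n} d (d ∘ flip i) ⟨
    ∑ (λ v → d v + d (flip i v))
      ≡⟨ ∑-cong {n} (λ v → trans
           (cong₂ (λ a b → d v + ⟦ a xor b ⟧) (lookup-flip i v) (lookup-flip′ (i≢j ∘ sym) v))
           (xor-not (lookup v i) (lookup v j))) ⟩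
    ∑ {n} (λ _ → 1)       ≡⟨ ∑-1 n ⟩
    2 ^ n ∎

  E≡ : ∑ (λ v → ⟦ F v ⟧ * d v) ≡ 2 * 2 ^ (n ∸ 3)
  E≡ = *-cancelˡ-≡ _ _ 2 (*-cancelˡ-≡ _ _ 2 (trans (cong (2 *_) (∑-selection sel d d-compl)) (trans ∑d (cong (2 ^_) (sym (m+[n∸m]≡n 3≤n))))))

  parity-eq : ∀ x y z → x + y ≡ 2 * z → parity x ≡ parity y
  parity-eq x y z e = ℙ.+-cancelʳ-≡ (parity y) (parity x) (parity y) (begin
    parity x ℙ.+ parity y ≡⟨ ℙ.+-homo-+ x y ⟨
    parity (x + y)        ≡⟨ cong parity e ⟩
    parity (z + (z + 0))  ≡⟨ cong (λ w → parity (z + w)) (+-identityʳ z) ⟩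
    parity (z + z)        ≡⟨ ℙ.+-homo-+ z z ⟩
    parity z ℙ.+ parity z ≡⟨ ℙ.p+p≡0ℙ (parity z) ⟩
    0ℙ                    ≡⟨ ℙ.p+p≡0ℙ (parity y) ⟨
    parity y ℙ.+ parity y ∎)

-- Exchanging balanced vectors

swap : ∀ {n} → Fin n → Fin n → Cube n → Cube n
swap i j v = flip i (flip j v)

record Exchangeable {n} (F : Family n) (i j : Fin n) : Set where
  field
    member   : Cube n
    selected : F member ≡ true
    has-i    : lookup member i ≡ true
    lacks-j  : lookup member j ≡ false
    missing  : F (swap i j member) ≡ false

-- Flipping both bits maps the vectors containing only `i` bijectively to those containing only `j`.
-- More members are of the first kind than of the second, so some member is mapped outside the
-- family.
exchangeable : ∀ {n} {F : Family n} {i j} → degree F j < degree F i → Exchangeable F i j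
exchangeable {n} {F} {i} {j} dj<di with ∑-<⇒∃ (λ v → ⟦ F (swap i j v) ⟧ * onlyI v) (λ v → ⟦ F v ⟧ * onlyI v) gap
  where
  i≢j : i ≢ j
  i≢j refl = <-irrefl refl dj<di

  onlyI onlyJ both : Cube n → ℕ
  onlyI v = ⟦ lookup v i ⟧ * ⟦ not (lookup v j) ⟧
  onlyJ v = ⟦ lookup v j ⟧ * ⟦ not (lookup v i) ⟧
  both  v = ⟦ lookup v i ⟧ * ⟦ lookup v j ⟧

  split : ∀ f a b → f * ⟦ a ⟧ ≡ f * (⟦ a ⟧ * ⟦ b ⟧) + f * (⟦ a ⟧ * ⟦ not b ⟧)
  split f true  true  = sym (trans (cong (f * 1 +_) (*-zeroʳ f)) (+-identityʳ (f * 1)))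
  split f true  false = cong (_+ f * 1) (sym (*-zeroʳ f))
  split f false b     = trans (sym (+-identityʳ (f * 0))) (cong (f * 0 +_) (sym (*-zeroʳ f)))

  degree-i : degree F i ≡ ∑ (λ v → ⟦ F v ⟧ * both v) + ∑ (λ v → ⟦ F v ⟧ * onlyI v)
  degree-i = trans (∑-cong {n} (λ v → split ⟦ F v ⟧ (lookup v i) (lookup v j)))
    (∑-+ {n} (λ v → ⟦ F v ⟧ * both v) (λ v → ⟦ F v ⟧ * onlyI v))

  degree-j : degree F j ≡ ∑ (λ v → ⟦ F v ⟧ * both v) + ∑ (λ v → ⟦ F v ⟧ * onlyJ v)
  degree-j = trans
    (∑-cong {n} (λ v → trans (split ⟦ F v ⟧ (lookup v j) (lookup v i))
      (cong (λ x → ⟦ F v ⟧ * x + ⟦ F v ⟧ * onlyJ v) (*-comm ⟦ lookup v j ⟧ ⟦ lookup v i ⟧))))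
    (∑-+ {n} (λ v → ⟦ F v ⟧ * both v) (λ v → ⟦ F v ⟧ * onlyJ v))

  onlyJ-swap : ∀ v → onlyJ (swap i j v) ≡ onlyI v
  onlyJ-swap v = begin
    onlyJ (swap i j v)
      ≡⟨ cong₂ (λ a b → ⟦ a ⟧ * ⟦ not b ⟧)
           (trans (lookup-flip′ (i≢j ∘ sym) (flip j v)) (lookup-flip j v))
           (trans (lookup-flip i (flip j v)) (cong not (lookup-flip′ i≢j v))) ⟩
    ⟦ not (lookup v j) ⟧ * ⟦ not (not (lookup v i)) ⟧
      ≡⟨ cong (λ b → ⟦ not (lookup v j) ⟧ * ⟦ b ⟧) (not-involutive (lookup v i)) ⟩
    ⟦ not (lookup v j) ⟧ * ⟦ lookup v i ⟧
      ≡⟨ *-comm ⟦ not (lookup v j) ⟧ ⟦ lookup v i ⟧ ⟩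
    onlyI v ∎

  reindex : ∑ (λ v → ⟦ F v ⟧ * onlyJ v) ≡ ∑ (λ v → ⟦ F (swap i j v) ⟧ * onlyI v)
  reindex = begin
    ∑ (λ v → ⟦ F v ⟧ * onlyJ v)
      ≡⟨ ∑-flip i (λ v → ⟦ F v ⟧ * onlyJ v) ⟨
    ∑ (λ v → ⟦ F (flip i v) ⟧ * onlyJ (flip i v))
      ≡⟨ ∑-flip j (λ v → ⟦ F (flip i v) ⟧ * onlyJ (flip i v)) ⟨
    ∑ (λ v → ⟦ F (swap i j v) ⟧ * onlyJ (swap i j v))
      ≡⟨ ∑-cong {n} (λ v → cong (⟦ F (swap i j v) ⟧ *_) (onlyJ-swap v)) ⟩
    ∑ (λ v → ⟦ F (swap i j v) ⟧ * onlyI v) ∎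

  gap : ∑ (λ v → ⟦ F (swap i j v) ⟧ * onlyI v) < ∑ (λ v → ⟦ F v ⟧ * onlyI v)
  gap = +-cancelˡ-< (∑ (λ v → ⟦ F v ⟧ * both v)) _ _
    (subst₂ _<_ (trans degree-j (cong (∑ (λ v → ⟦ F v ⟧ * both v) +_) reindex)) degree-i dj<di)
... | v , lt with F v in Fv | lookup v i in vi | lookup v j in vj | F (swap i j v) in Fs
... | true | true | false | false = record
  { member = v; selected = Fv; has-i = vi; lacks-j = vj; missing = Fs }
... | false | _     | _     | _    = contradiction lt λ ()
... | true  | false | _     | s    = contradiction lt (≤⇒≯ z≤n)
... | true  | true  | true  | s    = contradiction lt (≤⇒≯ z≤n)
... | true  | true  | false | true = contradiction lt (<-irrefl refl)

ones-flip : ∀ {n} i (v : Cube n) → ones (flip i v) + ⟦ lookup v i ⟧ ≡ ones v + ⟦ not (lookup v i) ⟧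
ones-flip zero    (b ∷ v) = exchange ⟦ not b ⟧ (ones v) ⟦ b ⟧
  where
  exchange : ∀ x y z → x + y + z ≡ z + y + x
  exchange = solve-∀
ones-flip (suc i) (b ∷ v) = trans (+-assoc ⟦ b ⟧ _ _) (trans (cong (⟦ b ⟧ +_) (ones-flip i v)) (sym (+-assoc ⟦ b ⟧ _ _)))

ones-swap : ∀ {n} {i j : Fin n} {v} → lookup v i ≡ true → lookup v j ≡ false → ones (swap i j v) ≡ ones v
ones-swap {i = i} {j} {v} vi vj = suc-injective (begin
  suc (ones (swap i j v))                         ≡⟨ +-comm 1 (ones (swap i j v)) ⟩
  ones (swap i j v) + 1                           ≡⟨ cong (λ b → ones (swap i j v) + ⟦ b ⟧) wi ⟨
  ones (swap i j v) + ⟦ lookup (flip j v) i ⟧     ≡⟨ ones-flip i (flip j v) ⟩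
  ones (flip j v) + ⟦ not (lookup (flip j v) i) ⟧ ≡⟨ cong (λ b → ones (flip j v) + ⟦ not b ⟧) wi ⟩
  ones (flip j v) + 0                             ≡⟨ cong (λ b → ones (flip j v) + ⟦ b ⟧) vj ⟨
  ones (flip j v) + ⟦ lookup v j ⟧                ≡⟨ ones-flip j v ⟩
  ones v + ⟦ not (lookup v j) ⟧                   ≡⟨ cong (λ b → ones v + ⟦ not b ⟧) vj ⟩
  ones v + 1                                      ≡⟨ +-comm (ones v) 1 ⟩
  suc (ones v) ∎)
  where
  i≢j : i ≢ j
  i≢j refl = contradiction (trans (sym vi) vj) λ ()
  wi : lookup (flip j v) i ≡ true
  wi = trans (lookup-flip′ i≢j v) vi

same-ones⇒same-zeros : ∀ {n} (u v : Cube n) → ones u ≡ ones v → zeros u ≡ zeros v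
same-ones⇒same-zeros u v e = +-cancelˡ-≡ (ones u) (zeros u) (zeros v)
  (trans (ones+zeros u) (trans (sym (ones+zeros v)) (cong (_+ zeros v) (sym e))))

Balanced : ∀ {n} → Cube n → Set
Balanced v = ones v ≡ zeros v

Balanced-compl : ∀ {n} {v : Cube n} → Balanced v → Balanced (compl v)
Balanced-compl {v = v} b = trans (sym b) (cong ones (sym (compl-involutive v)))

not-true : ∀ {x y} → x ≡ not y → y ≡ false → x ≡ true
not-true refl refl = refl

module _ {n} {F : Family n} {i j : Fin n} (sel : Selection F) (light : Light F) (ex : Exchangeable F i j) where
  open Exchangeable ex

  -- The swapped vector is not selected, so its complement is. Member and complement are both light,
  -- and their sizes add up to `n`, so both have size n/2. In particular an odd `n` admits no
  -- exchange: there all degrees of a light selection are already equal.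
  member-balanced : Balanced member
  member-balanced = ≤-antisym (light member selected) (subst₂ ℕ._≤_
    (same-ones⇒same-zeros (swap i j member) member same)
    (trans (cong ones (compl-involutive (swap i j member))) same)
    (light (compl (swap i j member)) (not-true (sel (swap i j member)) missing)))
    where same = ones-swap {v = member} has-i lacks-j

  swap-balanced : Balanced (compl (swap i j member))
  swap-balanced = Balanced-compl {v = swap i j member} (trans same
    (trans member-balanced (sym (same-ones⇒same-zeros (swap i j member) member same))))
    where same = ones-swap {v = member} has-i lacks-j

set : ∀ {n} → Family n → Cube n → Bool → Family n
set F a b v with v ≟ᶜ a
... | yes _ = b
... | no  _ = F v

set-same : ∀ {n} (F : Family n) a b → set F a b a ≡ b
set-same F a b with a ≟ᶜ a
... | yes _  = refl
... | no a≢a = contradiction refl a≢a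

set-other : ∀ {n} (F : Family n) {a} b {v} → v ≢ a → set F a b v ≡ F v
set-other F {a} b {v} v≢a with v ≟ᶜ a
... | yes v≡a = contradiction v≡a v≢a
... | no  _   = refl

∑-set : ∀ {n} (F : Family n) a b (h : Cube n → ℕ) →
        ∑ (λ v → ⟦ set F a b v ⟧ * h v) + ⟦ F a ⟧ * h a ≡ ∑ (λ v → ⟦ F v ⟧ * h v) + ⟦ b ⟧ * h a
∑-set F a b h = trans
  (∑-differ a (λ v v≢a → cong (λ x → ⟦ x ⟧ * h v) (set-other F b v≢a)))
  (cong (λ x → ∑ (λ v → ⟦ F v ⟧ * h v) + ⟦ x ⟧ * h a) (set-same F a b))

degree-set : ∀ {n} (F : Family n) a b k →
  degree (set F a b) k + ⟦ F a ⟧ * ⟦ lookup a k ⟧ ≡ degree F k + ⟦ b ⟧ * ⟦ lookup a k ⟧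
degree-set F a b k = ∑-set F a b (λ v → ⟦ lookup v k ⟧)

toggle : ∀ {n} → Family n → Cube n → Family n
toggle F a = set (set F a false) (compl a) true

module _ {n} {F : Family n} (sel : Selection F) {a} (Fa : F a ≡ true) where

  toggle-compl : toggle F a (compl a) ≡ true
  toggle-compl = set-same (set F a false) (compl a) true

  a≢compl : a ≢ compl a
  a≢compl e = not-¬ (cong F (sym e)) (sel a)

  toggle-self : toggle F a a ≡ false
  toggle-self = trans (set-other (set F a false) true a≢compl) (set-same F a false)

  toggle-other : ∀ {v} → v ≢ a → v ≢ compl a → toggle F a v ≡ F v
  toggle-other v≢a v≢ca = trans (set-other (set F a false) true v≢ca) (set-other F false v≢a)

  toggle-selection : Selection (toggle F a)
  toggle-selection v = cases (v ≟ᶜ a) (v ≟ᶜ compl a)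
    where
    cases : Dec (v ≡ a) → Dec (v ≡ compl a) → toggle F a (compl v) ≡ not (toggle F a v)
    cases (yes refl) _          = trans toggle-compl (sym (cong not toggle-self))
    cases (no _)     (yes refl) = trans (cong (toggle F a) (compl-involutive a))
      (trans toggle-self (sym (cong not toggle-compl)))
    cases (no v≢a)   (no v≢ca)  = trans
      (toggle-other
        (λ e → v≢ca (trans (sym (compl-involutive v)) (cong compl e)))
        (λ e → v≢a (trans (sym (compl-involutive v)) (trans (cong compl e) (compl-involutive a)))))
      (trans (sel v) (cong not (sym (toggle-other v≢a v≢ca))))

  toggle-light : Light F → Balanced a → Light (toggle F a)
  toggle-light light bal v Fv = cases (v ≟ᶜ a) (v ≟ᶜ compl a)
    where
    cases : Dec (v ≡ a) → Dec (v ≡ compl a) → ones v ℕ.≤ zeros v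
    cases (yes refl) _          = ≤-reflexive bal
    cases (no _)     (yes refl) = ≤-reflexive (Balanced-compl {v = a} bal)
    cases (no v≢a)   (no v≢ca)  = light v (trans (sym (toggle-other v≢a v≢ca)) Fv)

  degree-toggle : ∀ k → degree (toggle F a) k + ⟦ lookup a k ⟧ ≡ degree F k + ⟦ not (lookup a k) ⟧
  degree-toggle k = begin
    degree (toggle F a) k + ⟦ lookup a k ⟧
      ≡⟨ cong (_+ ⟦ lookup a k ⟧) removed ⟩
    degree (set F a false) k + ⟦ not (lookup a k) ⟧ + ⟦ lookup a k ⟧
      ≡⟨ exchange (degree (set F a false) k) ⟦ not (lookup a k) ⟧ ⟦ lookup a k ⟧ ⟩
    degree (set F a false) k + ⟦ lookup a k ⟧ + ⟦ not (lookup a k) ⟧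
      ≡⟨ cong (_+ ⟦ not (lookup a k) ⟧) added ⟩
    degree F k + ⟦ not (lookup a k) ⟧ ∎
    where
    exchange : ∀ x y z → x + y + z ≡ x + z + y
    exchange = solve-∀

    F¬ : set F a false (compl a) ≡ false
    F¬ = trans (set-other F false (a≢compl ∘ sym)) (trans (sel a) (cong not Fa))

    removed : degree (toggle F a) k ≡ degree (set F a false) k + ⟦ not (lookup a k) ⟧
    removed = begin
      degree (toggle F a) k
        ≡⟨ +-identityʳ _ ⟨
      degree (toggle F a) k + 0
        ≡⟨ cong (λ b → degree (toggle F a) k + ⟦ b ⟧ * ⟦ lookup (compl a) k ⟧) F¬ ⟨
      degree (toggle F a) k + ⟦ set F a false (compl a) ⟧ * ⟦ lookup (compl a) k ⟧
        ≡⟨ degree-set (set F a false) (compl a) true k ⟩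
      degree (set F a false) k + 1 * ⟦ lookup (compl a) k ⟧
        ≡⟨ cong (degree (set F a false) k +_) (trans (*-identityˡ _) (cong ⟦_⟧ (lookup-compl a k))) ⟩
      degree (set F a false) k + ⟦ not (lookup a k) ⟧ ∎

    added : degree (set F a false) k + ⟦ lookup a k ⟧ ≡ degree F k
    added = begin
      degree (set F a false) k + ⟦ lookup a k ⟧
        ≡⟨ cong (degree (set F a false) k +_) (trans (cong (λ b → ⟦ b ⟧ * ⟦ lookup a k ⟧) Fa) (*-identityˡ _)) ⟨
      degree (set F a false) k + ⟦ F a ⟧ * ⟦ lookup a k ⟧
        ≡⟨ degree-set F a false k ⟩
      degree F k + 0
        ≡⟨ +-identityʳ _ ⟩
      degree F k ∎

  toggle-parity : ∀ k → parity (degree (toggle F a) k) ≡ parity (degree F k) ℙ.⁻¹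
  toggle-parity k = flips (lookup a k) (degree-toggle k)
    where
    flips : ∀ {x y} b → x + ⟦ b ⟧ ≡ y + ⟦ not b ⟧ → parity x ≡ parity y ℙ.⁻¹
    flips {x} {y} true e = begin
      parity x                 ≡⟨ ℙ-inv (parity x) ⟩
      (parity x ℙ.⁻¹) ℙ.⁻¹     ≡⟨ cong ℙ._⁻¹ (trans (sym (suc-parity x)) (cong parity e′)) ⟩
      parity y ℙ.⁻¹ ∎
      where
      ℙ-inv : ∀ q → q ≡ (q ℙ.⁻¹) ℙ.⁻¹
      ℙ-inv 0ℙ = refl
      ℙ-inv 1ℙ = refl
      suc-parity : ∀ x → parity (suc x) ≡ parity x ℙ.⁻¹
      suc-parity x = ℙ.+-homo-+ 1 x
      e′ : suc x ≡ y
      e′ = trans (+-comm 1 x) (trans e (+-identityʳ y))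
    flips {x} {y} false e = trans (cong parity (trans (sym (+-identityʳ x)) (trans e (+-comm y 1)))) (ℙ.+-homo-+ 1 y)

avoid-two : ∀ {n} → 3 ℕ.≤ n → (i j : Fin n) → ∃[ k ] k ≢ i × k ≢ j
avoid-two (s≤s (s≤s (s≤s _))) zero          zero          = suc zero , (λ ()) , (λ ())
avoid-two (s≤s (s≤s (s≤s _))) zero          (suc zero)    = suc (suc zero) , (λ ()) , (λ ())
avoid-two (s≤s (s≤s (s≤s _))) zero          (suc (suc j)) = suc zero , (λ ()) , (λ ())
avoid-two (s≤s (s≤s (s≤s _))) (suc zero)    zero          = suc (suc zero) , (λ ()) , (λ ())
avoid-two (s≤s (s≤s (s≤s _))) (suc (suc i)) zero          = suc zero , (λ ()) , (λ ())
avoid-two (s≤s (s≤s (s≤s _))) (suc i)       (suc j)       = zero , (λ ()) , (λ ())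

-- Trading v and compl (swap i j v) for their complements moves two units of degree from i to j.
record Exchanged {n} (F : Family n) (i j : Fin n) : Set where
  field
    family     : Family n
    selection  : Selection family
    light      : Light family
    degree-i   : degree family i + 2 ≡ degree F i
    degree-j   : degree family j ≡ degree F j + 2
    degree-k   : ∀ k → k ≢ i → k ≢ j → degree family k ≡ degree F k

exchange : ∀ {n} {F : Family n} {i j} → 3 ℕ.≤ n → Selection F → Light F → degree F j < degree F i → Exchanged F i j
exchange {n} {F} {i} {j} 3≤n sel light dj<di = record
  { family    = toggle F₁ w
  ; selection = toggle-selection sel₁ F₁w
  ; light     = toggle-light sel₁ F₁w light₁ (swap-balanced sel light ex)
  ; degree-i  = from-i (balance i has-i s-i)
  ; degree-j  = from-j (balance j lacks-j s-j)
  ; degree-k  = λ k k≢i k≢j → from-k (lookup member k) (balance k refl (s-k k k≢i k≢j))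
  }
  where
  ex = exchangeable dj<di
  open Exchangeable ex

  i≢j : i ≢ j
  i≢j refl = <-irrefl refl dj<di

  s = swap i j member
  w = compl s
  F₁ = toggle F member
  sel₁ = toggle-selection sel selected
  light₁ = toggle-light sel selected light (member-balanced sel light ex)

  s-i : lookup s i ≡ false
  s-i = trans (lookup-flip i (flip j member)) (cong not (trans (lookup-flip′ i≢j member) has-i))

  s-j : lookup s j ≡ true
  s-j = trans (lookup-flip′ (i≢j ∘ sym) (flip j member)) (trans (lookup-flip j member) (cong not lacks-j))

  s-k : ∀ k → k ≢ i → k ≢ j → lookup s k ≡ lookup member k
  s-k k k≢i k≢j = trans (lookup-flip′ k≢i (flip j member)) (lookup-flip′ k≢j member)

  -- This is where n ≥ 3 is needed: for n = 2 the swap of a balanced vector is its complement.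
  w≢member : w ≢ member
  w≢member e = let (k , k≢i , k≢j) = avoid-two 3≤n i j in
    not-¬ (sym (s-k k k≢i k≢j)) (trans (cong (λ v → lookup v k) (sym e)) (lookup-compl s k))

  w≢compl : w ≢ compl member
  w≢compl e = contradiction
    (trans (sym s-i) (trans (cong (λ v → lookup v i)
      (trans (sym (compl-involutive s)) (trans (cong compl e) (compl-involutive member)))) has-i))
    λ ()

  F₁w : F₁ w ≡ true
  F₁w = trans (toggle-other sel selected w≢member w≢compl) (not-true (sel s) missing)

  combine : ∀ x y z a a′ b b′ → x + a ≡ y + a′ → y + b ≡ z + b′ → x + (a + b) ≡ z + (a′ + b′)
  combine x y z a a′ b b′ e₁ e₂ = begin
    x + (a + b)   ≡⟨ +-assoc x a b ⟨
    x + a + b     ≡⟨ cong (_+ b) e₁ ⟩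
    y + a′ + b    ≡⟨ rearrange y a′ b ⟩
    y + b + a′    ≡⟨ cong (_+ a′) e₂ ⟩
    z + b′ + a′   ≡⟨ rearrange′ z b′ a′ ⟩
    z + (a′ + b′) ∎
    where
    rearrange : ∀ y a b → y + a + b ≡ y + b + a
    rearrange = solve-∀
    rearrange′ : ∀ z b a → z + b + a ≡ z + (a + b)
    rearrange′ = solve-∀

  -- Away from `i` and `j` the vector `w` is opposite to `member`, so the effects of the two toggles
  -- cancel; at `i` and at `j` the two vectors agree, so the effects add up to two units.
  balance : ∀ k {x y} → lookup member k ≡ x → lookup s k ≡ y →
    degree (toggle F₁ w) k + (⟦ not y ⟧ + ⟦ x ⟧) ≡ degree F k + (⟦ y ⟧ + ⟦ not x ⟧)
  balance k {x} {y} mk sk = combine (degree (toggle F₁ w) k) (degree F₁ k) (degree F k) ⟦ not y ⟧ ⟦ y ⟧ ⟦ x ⟧ ⟦ not x ⟧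
    (subst₂ (λ a b → degree (toggle F₁ w) k + ⟦ a ⟧ ≡ degree F₁ k + ⟦ b ⟧) wk
      (trans (cong not wk) (not-involutive y)) (degree-toggle sel₁ F₁w k))
    (subst (λ a → degree F₁ k + ⟦ a ⟧ ≡ degree F k + ⟦ not a ⟧) mk (degree-toggle sel selected k))
    where
    wk : lookup w k ≡ not y
    wk = trans (lookup-compl s k) (cong not sk)

  from-i : ∀ {x y} → x + 2 ≡ y + 0 → x + 2 ≡ y
  from-i e = trans e (+-identityʳ _)

  from-j : ∀ {x y} → x + 0 ≡ y + 2 → x ≡ y + 2
  from-j e = trans (sym (+-identityʳ _)) e

  from-k : ∀ {x y} b → x + (⟦ not b ⟧ + ⟦ b ⟧) ≡ y + (⟦ b ⟧ + ⟦ not b ⟧) → x ≡ y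
  from-k {x} {y} true  e = +-cancelʳ-≡ 1 x y e
  from-k {x} {y} false e = +-cancelʳ-≡ 1 x y e

-- Levelling the degrees

Fin-sum-mono : ∀ {n} {f g : Fin n → ℕ} → (∀ k → f k ℕ.≤ g k) → Σℕ.sum f ℕ.≤ Σℕ.sum g
Fin-sum-mono {zero}  h = z≤n
Fin-sum-mono {suc n} h = +-mono-≤ (h zero) (Fin-sum-mono (h ∘ suc))

Fin-sum-mono-< : ∀ {n} {f g : Fin n → ℕ} i → (∀ k → f k ℕ.≤ g k) → f i < g i → Σℕ.sum f < Σℕ.sum g
Fin-sum-mono-< zero    h lt = +-mono-<-≤ lt (Fin-sum-mono (h ∘ suc))
Fin-sum-mono-< (suc i) h lt = +-mono-≤-< (h zero) (Fin-sum-mono-< i (h ∘ suc) lt)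

Fin-sum-const : ∀ n c → Σℕ.sum {n} (λ _ → c) ≡ n * c
Fin-sum-const zero    c = refl
Fin-sum-const (suc n) c = cong (c +_) (Fin-sum-const n c)

some-below : ∀ {n} (f : Fin n → ℕ) c → Σℕ.sum f ℕ.≤ n * c → ∀ {i} → c < f i → ∃[ j ] f j < c
some-below {n} f c le {i} c<fi with any? (λ j → f j <? c)
... | yes found = found
... | no  none  = contradiction
  (<-≤-trans (Fin-sum-mono-< i (λ k → ≮⇒≥ (λ lt → none (k , lt))) c<fi) le)
  (<-irrefl (Fin-sum-const n c))

same-parity-gap : ∀ a b → parity a ≡ parity b → a < b → a + 2 ℕ.≤ b
same-parity-gap zero    (suc zero)    ()
same-parity-gap zero    (suc (suc b)) _ _         = s≤s (s≤s z≤n)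
same-parity-gap (suc a) (suc b)       e (s≤s a<b) = s≤s (same-parity-gap a b (cancel e) a<b)
  where
  cancel : parity (suc a) ≡ parity (suc b) → parity a ≡ parity b
  cancel e = ℙ.+-cancelˡ-≡ 1ℙ (parity a) (parity b)
    (trans (sym (ℙ.+-homo-+ 1 a)) (trans e (ℙ.+-homo-+ 1 b)))

record BoundedSelection (n c : ℕ) : Set where
  field
    family    : Family n
    selection : Selection family
    bounded   : ∀ i → degree family i ℕ.≤ c

∑Fin-degree-≤ : ∀ {p c} {F : Family (suc p)} → 2 ^ p ℕ.≤ 2 * c + midBinomial (suc p) →
                Selection F → Light F → Σℕ.sum (degree F) ℕ.≤ suc p * c
∑Fin-degree-≤ {p} {c} {F} 2^p≤ sel light = *-cancelˡ-≤ 2 (+-cancelʳ-≤ (suc p * b) _ _ (R.begin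
  2 * Σℕ.sum (degree F) + suc p * b  R.≡⟨ ∑Fin-degree-light sel light ⟩
  suc p * 2 ^ p                      R.≤⟨ *-monoʳ-≤ (suc p) 2^p≤ ⟩
  suc p * (2 * c + b)                R.≡⟨ distrib (suc p) c b ⟩
  2 * (suc p * c) + suc p * b        R.∎))
  where
  module R = ≤-Reasoning
  b = midBinomial (suc p)
  distrib : ∀ x c b → x * (2 * c + b) ≡ 2 * (x * c) + x * b
  distrib = solve-∀

module _ {n} (3≤n : 3 ℕ.≤ n) (c : ℕ)
  (∑degree≤ : ∀ {F : Family n} → Selection F → Light F → Σℕ.sum (degree F) ℕ.≤ n * c) where

  excess : Family n → ℕ
  excess F = Σℕ.sum (λ i → degree F i ∸ c)

  -- With all degrees of the parity of `c`, a degree above `c` is at least `c + 2`, and the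
  -- averaging bound supplies one that is at most `c` minus 2. Moving two units from the former to
  -- the latter lowers the total excess and creates no new one, and it keeps all parities.
  reduce-excess : ∀ fuel F → excess F < fuel → Selection F → Light F →
                  (∀ i → parity (degree F i) ≡ parity c) → BoundedSelection n c
  reduce-excess (suc fuel) F (s≤s exc≤) sel light par with any? (λ i → c <? degree F i)
  ... | no  none       = record { family = F; selection = sel; bounded = λ i → ≮⇒≥ (λ lt → none (i , lt)) }
  ... | yes (i , c<di) with some-below (degree F) c (∑degree≤ sel light) c<di
  ...   | j , dj<c = reduce-excess fuel family (≤-trans smaller exc≤) selection E.light
                       (λ k → trans (degree-parity 3≤n selection k j) (trans par-j (par j)))
    where
    E = exchange 3≤n sel light (<-trans dj<c c<di)
    module E = Exchanged E
    open Exchanged E hiding (light)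

    par-j : parity (degree family j) ≡ parity (degree F j)
    par-j = trans (cong parity degree-j) (trans (ℙ.+-homo-+ (degree F j) 2) (ℙ.+-identityʳ _))

    di′<di : degree family i < degree F i
    di′<di = subst (degree family i <_) degree-i (m<m+n (degree family i) z<s)

    monotone : ∀ k → degree family k ∸ c ℕ.≤ degree F k ∸ c
    monotone k = cases (k ≟ᶠ i) (k ≟ᶠ j)
      where
      cases : Dec (k ≡ i) → Dec (k ≡ j) → degree family k ∸ c ℕ.≤ degree F k ∸ c
      cases (yes refl) _          = ∸-monoˡ-≤ c (<⇒≤ di′<di)
      cases (no _)     (yes refl) = subst (ℕ._≤ degree F k ∸ c)
        (sym (m≤n⇒m∸n≡0 (subst (ℕ._≤ c) (sym degree-j) (same-parity-gap (degree F k) c (par k) dj<c)))) z≤n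
      cases (no k≢i)   (no k≢j)   = ≤-reflexive (cong (_∸ c) (degree-k k k≢i k≢j))

    smaller : excess family < excess F
    smaller = Fin-sum-mono-< i monotone
      (∸-monoˡ-< di′<di (+-cancelʳ-≤ 2 c (degree family i)
        (subst (c + 2 ℕ.≤_) (sym degree-i) (same-parity-gap c (degree F i) (sym (par i)) c<di))))

  -- Exchanges move degrees by two, so they can reach the bound only if the degrees have the parity of c;
  -- otherwise toggling a single balanced vector first changes the parity of all degrees.
  bound-light : ∀ {F : Family n} → Selection F → Light F → BoundedSelection n c
  bound-light {F} sel light with any? (λ i → c <? degree F i)
  ... | no  none       = record { family = F; selection = sel; bounded = λ i → ≮⇒≥ (λ lt → none (i , lt)) }
  ... | yes (i , c<di) with parity (degree F i) ℙ.≟ parity c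
  ...   | yes par = reduce-excess (suc (excess F)) F ≤-refl sel light (λ k → trans (degree-parity 3≤n sel k i) par)
  ...   | no ¬par with some-below (degree F) c (∑degree≤ sel light) c<di
  ...     | j , dj<c = reduce-excess (suc (excess F₁)) F₁ ≤-refl (toggle-selection sel selected)
                         (toggle-light sel selected light (member-balanced sel light ex))
                         (λ k → trans (toggle-parity sel selected k)
                           (trans (cong ℙ._⁻¹ (degree-parity 3≤n sel k i)) (opposite (parity (degree F i)) (parity c) ¬par)))
    where
    ex = exchangeable (<-trans dj<c c<di)
    open Exchangeable ex
    F₁ = toggle F member
    opposite : ∀ x y → x ≢ y → x ℙ.⁻¹ ≡ y
    opposite 0ℙ 0ℙ ne = contradiction refl ne
    opposite 0ℙ 1ℙ ne = refl
    opposite 1ℙ 0ℙ ne = refl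
    opposite 1ℙ 1ℙ ne = contradiction refl ne

-- Complementary vectors differ in their first coordinate, so `head` breaks the tie within each
-- balanced pair.
minority : ∀ {n} → Family (suc n)
minority v with <-cmp (ones v) (zeros v)
... | tri< _ _ _ = true
... | tri≈ _ _ _ = head v
... | tri> _ _ _ = false

minority-light : ∀ {n} → Light (minority {n})
minority-light v e with <-cmp (ones v) (zeros v)
... | tri< lt _ _ = <⇒≤ lt
... | tri≈ _ eq _ = ≤-reflexive eq

minority-selection : ∀ {n} → Selection (minority {n})
minority-selection v@(b ∷ _) with <-cmp (ones v) (zeros v) | <-cmp (ones (compl v)) (zeros (compl v)) | cong ones (compl-involutive v)
... | tri< lt _ _  | tri> _ _ _   | e = refl
... | tri≈ _ _ _   | tri≈ _ _ _   | e = refl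
... | tri> _ _ _   | tri< _ _ _   | e = refl
... | tri< lt _ _  | tri< lt′ _ _ | e = contradiction (subst (zeros v <_) e lt′) (<-asym lt)
... | tri< lt _ _  | tri≈ _ eq _  | e = contradiction lt (<-irrefl (trans (sym e) (sym eq)))
... | tri≈ _ eq _  | tri< lt′ _ _ | e = contradiction lt′ (<-irrefl (trans (sym eq) (sym e)))
... | tri≈ _ eq _  | tri> _ _ gt  | e = contradiction gt (<-irrefl (trans e eq))
... | tri> _ _ gt  | tri≈ _ eq _  | e = contradiction gt (<-irrefl (trans eq e))
... | tri> _ _ gt  | tri> _ _ gt′ | e = contradiction (subst (_< zeros v) e gt′) (<-asym gt)

bounded-selection : ∀ p c → 2 ^ suc p ℕ.≤ 2 * c + midBinomial (2 + p) → BoundedSelection (2 + p) c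
bounded-selection (suc p) c       h = bound-light (s≤s (s≤s (s≤s z≤n))) c (∑Fin-degree-≤ {c = c} h) minority-selection minority-light
-- Exchanges need three coordinates, so dimension 2 is settled directly: `c` = 0 would mean 2 ≤ 1,
-- and otherwise the degrees 1 and 0 of `minority` suffice.
bounded-selection zero    zero    (s≤s ())
bounded-selection zero    (suc c) h = record
  { family = minority; selection = minority-selection
  ; bounded = λ { zero → s≤s z≤n; (suc zero) → z≤n } }

-- Chooser's strategy

open import Data.Integer as ℤ using (ℤ; +_; -[1+_]; +≤+; ∣_∣)
import Data.Integer.Properties as ℤ
import Data.Integer.Tactic.RingSolver as ℤ-Solver

module Σℤ where
  open MonoidSum ℤ.+-0-commutativeMonoid public
  open SemiringSum ℤ.+-*-semiring public using (*-distribˡ-sum)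

ℤ-cancelʳ : ∀ x y z → y ℤ.+ x ≡ z ℤ.+ x → y ≡ z
ℤ-cancelʳ = Group.∙-cancelʳ (AbelianGroup.group ℤ.+-0-abelianGroup)

spin : Bool → ℤ
spin true  = + 1
spin false = ℤ.- (+ 1)

spin-not : ∀ b → spin (not b) ≡ ℤ.- spin b
spin-not true  = refl
spin-not false = refl

positive : ℤ → Bool
positive (+ _)    = true
positive -[1+ _ ] = false

code : ∀ {n} → Point n → Cube n
code v = tabulate (λ i → positive (v i))

spin-code : ∀ {n} {v : Point n} → Vset n v → ∀ i → spin (lookup (code v) i) ≡ v i
spin-code {v = v} (±1 , _) i = trans (cong spin (lookup∘tabulate (λ i → positive (v i)) i)) (unit (±1 i))
  where
  unit : ∀ {z} → z ≡ + 1 ⊎ z ≡ ℤ.- (+ 1) → spin (positive z) ≡ z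
  unit (inj₁ refl) = refl
  unit (inj₂ refl) = refl

history-suc : ∀ {n} (p : ℕ → Point n) k → history p (suc k) ≡ history p k ∷ʳ p k
history-suc p k = begin
  history p (suc k)           ≡⟨ map-upTo p (suc k) ⟩
  applyUpTo p (suc k) ≡⟨ applyUpTo-∷ʳ p k ⟨
  applyUpTo p k ∷ʳ p k ≡⟨ cong (_∷ʳ p k) (map-upTo p k) ⟨
  history p k ∷ʳ p k          ∎

-- Chooser answers every other offer of a pair ±v by returning: the first answer adds the member of
-- the pair lying in F, the next one subtracts it. The position is thus always a sum of distinct members of F.
module Alternating {n} {F : Family n} (sel : Selection F) where

  rep : Cube n → Cube n
  rep v = if F v then v else compl v

  record-offer : Family n → Point n → Family n
  record-offer P u = set P (rep (code u)) (not (P (rep (code u))))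

  -- The parity of the number of past offers from each pair, stored at the representative. It is
  -- recomputed from the history, the only memory a strategy has.
  pending : List (Point n) → Family n
  pending = foldl record-offer (λ _ → false)

  toSign : Bool → Sign
  toSign true  = Sign.+
  toSign false = Sign.-

  strategy : ChooserStrategy n
  strategy past u = toSign (F (code u) xor pending past (rep (code u)))

  rep∈F : ∀ v → F (rep v) ≡ true
  rep∈F v with F v in Fv
  ... | true  = Fv
  ... | false = trans (sel v) (cong not Fv)

  -- The `xor` with `F (code u)` undoes the change of sign when the offered vector is the complement
  -- of its representative. Hence the move depends only on the representative and on whether it is
  -- pending.
  move : ∀ {u} → Vset n u → ∀ b i →
    signℤ (toSign (F (code u) xor b)) ℤ.* u i ≡ spin (not b) ℤ.* spin (lookup (rep (code u)) i)
  move {u} valid b i with F (code u) | spin-code valid i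
  ... | true  | e = cong₂ ℤ._*_ (signs b) (sym e)
    where
    signs : ∀ b → signℤ (toSign (true xor b)) ≡ spin (not b)
    signs true  = refl
    signs false = refl
  ... | false | e = begin
    signℤ (toSign b) ℤ.* u i
      ≡⟨ cong₂ ℤ._*_ (signs b) (sym e) ⟩
    (ℤ.- spin (not b)) ℤ.* spin (lookup (code u) i)
      ≡⟨ swap-neg (spin (not b)) (spin (lookup (code u) i)) ⟩
    spin (not b) ℤ.* (ℤ.- spin (lookup (code u) i))
      ≡⟨ cong (spin (not b) ℤ.*_) (trans (cong spin (lookup-compl (code u) i)) (spin-not (lookup (code u) i))) ⟨
    spin (not b) ℤ.* spin (lookup (compl (code u)) i) ∎
    where
    signs : ∀ b → signℤ (toSign b) ≡ ℤ.- spin (not b)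
    signs true  = refl
    signs false = refl
    swap-neg : ∀ x y → (ℤ.- x) ℤ.* y ≡ x ℤ.* (ℤ.- y)
    swap-neg = ℤ-Solver.solve-∀

  codegree : Family n → Fin n → ℕ
  codegree P i = ∑ (λ v → ⟦ P v ⟧ * ⟦ not (lookup v i) ⟧)

  -- This says that `z` is the sum of the ±1 vectors in `P`, with the negative contributions moved
  -- to the left; dropping them later leaves the bound by the degree.
  Represents : Family n → Point n → Set
  Represents P z = ∀ i → z i ℤ.+ + codegree P i ≡ + degree P i

  advance : ∀ {z d d′ e e′} b a → d′ + ⟦ b ⟧ * ⟦ a ⟧ ≡ d + ⟦ not b ⟧ * ⟦ a ⟧ →
    e′ + ⟦ b ⟧ * ⟦ not a ⟧ ≡ e + ⟦ not b ⟧ * ⟦ not a ⟧ →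
    z ℤ.+ + e ≡ + d → (z ℤ.+ spin (not b) ℤ.* spin a) ℤ.+ + e′ ≡ + d′
  advance {z} {d} {d′} {e} {e′} b a eq-d eq-e inv = ℤ-cancelʳ (+ (x + y)) _ _ (begin
    z ℤ.+ s ℤ.+ + e′ ℤ.+ (+ (x + y))     ≡⟨ cong (ℤ._+_ (z ℤ.+ s ℤ.+ + e′)) (ℤ.pos-+ x y) ⟩
    z ℤ.+ s ℤ.+ + e′ ℤ.+ (+ x ℤ.+ + y)   ≡⟨ regroup z s (+ e′) (+ x) (+ y) ⟩
    z ℤ.+ (s ℤ.+ + x) ℤ.+ (+ e′ ℤ.+ + y) ≡⟨ cong₂ (λ p q → z ℤ.+ p ℤ.+ q) (spins b a) (trans (sym (ℤ.pos-+ e′ y)) (trans (cong +_ eq-e) (ℤ.pos-+ e y′))) ⟩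
    z ℤ.+ (+ x′ ℤ.+ (+ y ℤ.- + y′)) ℤ.+ (+ e ℤ.+ + y′) ≡⟨ regroup′ z (+ x′) (+ y) (+ y′) (+ e) ⟩
    (z ℤ.+ + e) ℤ.+ + x′ ℤ.+ + y         ≡⟨ cong (λ p → p ℤ.+ + x′ ℤ.+ + y) inv ⟩
    + d ℤ.+ + x′ ℤ.+ + y                 ≡⟨ cong (ℤ._+ + y) (trans (sym (ℤ.pos-+ d x′)) (trans (cong +_ (sym eq-d)) (ℤ.pos-+ d′ x))) ⟩
    + d′ ℤ.+ + x ℤ.+ + y                 ≡⟨ ℤ.+-assoc (+ d′) (+ x) (+ y) ⟩
    + d′ ℤ.+ (+ x ℤ.+ + y)               ≡⟨ cong (ℤ._+_ (+ d′)) (ℤ.pos-+ x y) ⟨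
    + d′ ℤ.+ (+ (x + y)) ∎)
    where
    s = spin (not b) ℤ.* spin a
    x = ⟦ b ⟧ * ⟦ a ⟧
    x′ = ⟦ not b ⟧ * ⟦ a ⟧
    y = ⟦ b ⟧ * ⟦ not a ⟧
    y′ = ⟦ not b ⟧ * ⟦ not a ⟧

    spins : ∀ b a → spin (not b) ℤ.* spin a ℤ.+ + (⟦ b ⟧ * ⟦ a ⟧) ≡
      + (⟦ not b ⟧ * ⟦ a ⟧) ℤ.+ (+ (⟦ b ⟧ * ⟦ not a ⟧) ℤ.- + (⟦ not b ⟧ * ⟦ not a ⟧))
    spins true  true  = refl
    spins true  false = refl
    spins false true  = refl
    spins false false = refl

    regroup : ∀ z s e x y → z ℤ.+ s ℤ.+ e ℤ.+ (x ℤ.+ y) ≡ z ℤ.+ (s ℤ.+ x) ℤ.+ (e ℤ.+ y)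
    regroup = ℤ-Solver.solve-∀

    regroup′ : ∀ z x′ y y′ e → z ℤ.+ (x′ ℤ.+ (y ℤ.- y′)) ℤ.+ (e ℤ.+ y′) ≡ (z ℤ.+ e) ℤ.+ x′ ℤ.+ y
    regroup′ = ℤ-Solver.solve-∀

  module _ (p : ℕ → Point n) (valid : ∀ k → Vset n (p k)) where

    pending-suc : ∀ k → pending (history p (suc k)) ≡ record-offer (pending (history p k)) (p k)
    pending-suc k = trans (cong pending (history-suc p k)) (foldl-∷ʳ record-offer (λ _ → false) (p k) (history p k))

    position-represented : ∀ k → Represents (pending (history p k)) (position strategy p k)
    position-represented zero i =
      cong +_ (trans (∑-const n 0) (sym (∑-const n 0)))
    position-represented (suc k) i = subst (λ P → position strategy p (suc k) i ℤ.+ + codegree P i ≡ + degree P i)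
      (sym (pending-suc k))
      (subst (λ m → (z i ℤ.+ m) ℤ.+ + codegree P′ i ≡ + degree P′ i) (sym (move (valid k) (P a) i))
        (advance {z = z i} (P a) (lookup a i)
          (degree-set P a (not (P a)) i)
          (∑-set P a (not (P a)) (λ v → ⟦ not (lookup v i) ⟧))
          (position-represented k i)))
      where
      z = position strategy p k
      P = pending (history p k)
      a = rep (code (p k))
      P′ = record-offer P (p k)

    pending⊆F : ∀ k v → pending (history p k) v ≡ true → F v ≡ true
    pending⊆F (suc k) v Pv = cases (v ≟ᶜ a) (subst (λ P → P v ≡ true) (pending-suc k) Pv)
      where
      a = rep (code (p k))
      cases : Dec (v ≡ a) → record-offer (pending (history p k)) (p k) v ≡ true → F v ≡ true
      cases (yes refl) _  = rep∈F (code (p k))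
      cases (no v≢a)   P′v = pending⊆F k v (trans (sym (set-other (pending (history p k)) _ v≢a)) P′v)

    position≤degree : ∀ k i → position strategy p k i ℤ.≤ + degree F i
    position≤degree k i = ℤ.≤-trans
      (subst (position strategy p k i ℤ.≤_) (position-represented k i) (ℤ.i≤i+j _ (+ codegree (pending (history p k)) i)))
      (+≤+ (∑-mono {n} (λ v → *-monoˡ-≤ ⟦ lookup v i ⟧ (indicator-mono _ _ (pending⊆F k v)))))
      where
      indicator-mono : ∀ a b → (a ≡ true → b ≡ true) → ⟦ a ⟧ ℕ.≤ ⟦ b ⟧
      indicator-mono false b    h = z≤n
      indicator-mono true  b    h = ≤-reflexive (cong ⟦_⟧ (sym (h refl)))

chooser-keeps-below : ∀ p c → 2 ^ suc p ℕ.≤ 2 * c + midBinomial (2 + p) →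
                      ChooserWins (Vset (2 + p)) (λ x → ∀ i → x i ℤ.≤ + c)
chooser-keeps-below p c h = strategy , λ offers valid k i →
  ℤ.≤-trans (position≤degree offers valid k i) (+≤+ (bounded i))
  where
  open BoundedSelection (bounded-selection p c h)
  open Alternating selection

-- Pusher's strategy

applyUpTo-cong : ∀ {A : Set} {f g : ℕ → A} k → (∀ j → j < k → f j ≡ g j) → applyUpTo f k ≡ applyUpTo g k
applyUpTo-cong zero    h = refl
applyUpTo-cong (suc k) h = cong₂ _∷_ (h 0 z<s) (applyUpTo-cong k (λ j j<k → h (suc j) (s<s j<k)))

history-cong : ∀ {n} {p q : ℕ → Point n} k → (∀ j → j < k → p j ≡ q j) → history p k ≡ history q k
history-cong {p = p} {q} k h = trans (map-upTo p k) (trans (applyUpTo-cong k h) (sym (map-upTo q k)))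

-- A position depends only on the offers made before it, so a play can be cut off at any round and
-- continued with a freely chosen offer.
position-cong : ∀ {n} (σ : ChooserStrategy n) {p q : ℕ → Point n} k →
                (∀ j → j < k → p j ≡ q j) → position σ p k ≡ position σ q k
position-cong σ         zero    h = refl
position-cong σ {p} {q} (suc k) h
  rewrite position-cong σ {p} {q} k (λ j j<k → h j (m<n⇒m<1+n j<k))
        | history-cong {p = p} {q} k (λ j j<k → h j (m<n⇒m<1+n j<k))
        | h k ≤-refl = refl

vertex : ∀ {n} → Cube n → Point n
vertex v i = spin (lookup v i)

shift : ∀ {n} → Point n → Bool → Cube n → Point n
shift z b v i = z i ℤ.+ spin b ℤ.* vertex v i

module _ {n} (σ : ChooserStrategy n) where

  record Reachable (z : Point n) : Set where
    field
      offers : ℕ → Point n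
      valid  : ∀ j → Vset n (offers j)
      round  : ℕ
      at     : ∀ i → position σ offers round i ≡ z i

  module _ {z : Point n} (r : Reachable z) {u : Point n} (u∈V : Vset n u) where
    open Reachable r

    private
      continued : ℕ → Point n
      continued j with j <? round
      ... | yes _ = offers j
      ... | no  _ = u

      continued-valid : ∀ j → Vset n (continued j)
      continued-valid j with j <? round
      ... | yes _ = valid j
      ... | no  _ = u∈V

      continued-< : ∀ j → j < round → continued j ≡ offers j
      continued-< j j<round with j <? round
      ... | yes _  = refl
      ... | no j≮ = contradiction j<round j≮

      continued-round : continued round ≡ u
      continued-round with round <? round
      ... | yes r<r = contradiction r<r (<-irrefl refl)
      ... | no _    = refl

      response : Sign
      response = σ (history continued round) (continued round)

    offer : ∃[ ε ] Reachable (λ i → z i ℤ.+ signℤ ε ℤ.* u i)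
    offer = response , record
      { offers = continued; valid = continued-valid; round = suc round
      ; at = λ i → cong₂ (λ x w → x ℤ.+ signℤ response ℤ.* w)
               (trans (cong (λ f → f i) (position-cong σ round continued-<)) (at i))
               (cong (λ f → f i) continued-round) }

  Reachable-resp : ∀ {z z′} → (∀ i → z i ≡ z′ i) → Reachable z → Reachable z′
  Reachable-resp e r = record { Reachable r; at = λ i → trans (Reachable.at r i) (e i) }

±spin : ∀ b → spin b ≡ + 1 ⊎ spin b ≡ ℤ.- (+ 1)
±spin true  = inj₁ refl
±spin false = inj₂ refl

vertex∈V : ∀ {n} (v : Cube n) → Vset (suc n) (vertex (true ∷ v))
vertex∈V v = (λ i → ±spin (lookup (true ∷ v) i)) , λ { zero _ → refl; (suc i) () }

-- Offering the complement amounts to offering the vector itself with Chooser's two answers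
-- interchanged. Pusher can therefore act as if every vertex of the cube were available, in
-- particular at a crossing where the first coordinate of the vector is -1.
offer-vertex : ∀ {n} (σ : ChooserStrategy (suc n)) {z} → Reachable σ z → ∀ v → ∃[ b ] Reachable σ (shift z b v)
offer-vertex σ {z} r (true ∷ v) with offer σ r (vertex∈V v)
... | Sign.+ , r′ = true  , r′
... | Sign.- , r′ = false , r′
offer-vertex σ {z} r (false ∷ v) with offer σ r (vertex∈V (compl v))
... | Sign.+ , r′ = false , Reachable-resp σ (λ i → cong (ℤ._+_ (z i)) (negate (+ 1) i)) r′
  where
  negate : ∀ s i → s ℤ.* vertex (true ∷ compl v) i ≡ (ℤ.- s) ℤ.* vertex (false ∷ v) i
  negate s i = trans (cong (s ℤ.*_) (trans (cong spin (lookup-compl (false ∷ v) i)) (spin-not (lookup (false ∷ v) i))))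
    (swap-neg s (vertex (false ∷ v) i))
    where
    swap-neg : ∀ x y → x ℤ.* (ℤ.- y) ≡ (ℤ.- x) ℤ.* y
    swap-neg = ℤ-Solver.solve-∀
... | Sign.- , r′ = true , Reachable-resp σ (λ i → cong (ℤ._+_ (z i)) (negate i)) r′
  where
  negate : ∀ i → (ℤ.- (+ 1)) ℤ.* vertex (true ∷ compl v) i ≡ (+ 1) ℤ.* vertex (false ∷ v) i
  negate i = trans (cong ((ℤ.- (+ 1)) ℤ.*_) (trans (cong spin (lookup-compl (false ∷ v) i)) (spin-not (lookup (false ∷ v) i))))
    (swap-neg (vertex (false ∷ v) i))
    where
    swap-neg : ∀ y → (ℤ.- (+ 1)) ℤ.* (ℤ.- y) ≡ (+ 1) ℤ.* y
    swap-neg = ℤ-Solver.solve-∀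

-- A point that is not maximal has a strictly better one, and each improvement shrinks the integral
-- gap to `B`, which serves as fuel. Refuting that all points improve does not exhibit a maximum,
-- hence the double negation.
¬¬maximum : ∀ {A : Set} (φ : A → ℤ) B → (∀ x → φ x ℤ.≤ B) → A → ¬ ¬ (∃[ x ] ∀ y → φ y ℤ.≤ φ x)
¬¬maximum φ B bound x₀ = go ∣ B ℤ.- φ x₀ ∣ x₀
  (subst (ℤ._≤ φ x₀ ℤ.+ + ∣ B ℤ.- φ x₀ ∣) (cancel B (φ x₀)) (ℤ.+-monoʳ-≤ (φ x₀) (i≤∣i∣ (B ℤ.- φ x₀))))
  where
  cancel : ∀ b f → f ℤ.+ (b ℤ.- f) ≡ b
  cancel = ℤ-Solver.solve-∀

  i≤∣i∣ : ∀ i → i ℤ.≤ + ∣ i ∣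
  i≤∣i∣ (+ n)    = ℤ.≤-refl
  i≤∣i∣ -[1+ n ] = ℤ.-≤+

  go : ∀ fuel x → B ℤ.≤ φ x ℤ.+ + fuel → ¬ ¬ (∃[ x ] ∀ y → φ y ℤ.≤ φ x)
  go zero x B≤ none = none (x , λ y → ℤ.≤-trans (bound y) (subst (B ℤ.≤_) (ℤ.+-identityʳ (φ x)) B≤))
  go (suc fuel) x B≤ none = none (x , below)
    where
    below : ∀ y → φ y ℤ.≤ φ x
    below y with φ y ℤ.≤? φ x
    ... | yes φy≤ = φy≤
    ... | no  φy≰ = ⊥-elim (go fuel y
      (ℤ.≤-trans B≤ (subst (ℤ._≤ φ y ℤ.+ + fuel) (shift-suc (φ x) (+ fuel))
        (ℤ.+-monoˡ-≤ (+ fuel) (ℤ.i<j⇒suc[i]≤j (ℤ.≰⇒> φy≰))))) none)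
      where
      shift-suc : ∀ f k → (+ 1 ℤ.+ f) ℤ.+ k ≡ f ℤ.+ (+ 1 ℤ.+ k)
      shift-suc = ℤ-Solver.solve-∀

-- Maximisers of a moving functional

dot : ∀ {n} → (Fin n → ℕ) → Point n → ℤ
dot a z = Σℤ.sum (λ i → + a i ℤ.* z i)

dot-shift : ∀ {n} (a : Fin n → ℕ) z b v → dot a (shift z b v) ≡ dot a z ℤ.+ spin b ℤ.* dot a (vertex v)
dot-shift a z b v = begin
  dot a (shift z b v)
    ≡⟨ Σℤ.sum-cong-≗ (λ i → distrib (+ a i) (z i) (spin b) (vertex v i)) ⟩
  Σℤ.sum (λ i → + a i ℤ.* z i ℤ.+ spin b ℤ.* (+ a i ℤ.* vertex v i))
    ≡⟨ Σℤ.∑-distrib-+ (λ i → + a i ℤ.* z i) (λ i → spin b ℤ.* (+ a i ℤ.* vertex v i)) ⟩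
  dot a z ℤ.+ Σℤ.sum (λ i → spin b ℤ.* (+ a i ℤ.* vertex v i))
    ≡⟨ cong (ℤ._+_ (dot a z)) (Σℤ.*-distribˡ-sum (spin b) (λ i → + a i ℤ.* vertex v i)) ⟨
  dot a z ℤ.+ spin b ℤ.* dot a (vertex v) ∎
  where
  distrib : ∀ a z s v → a ℤ.* (z ℤ.+ s ℤ.* v) ≡ a ℤ.* z ℤ.+ s ℤ.* (a ℤ.* v)
  distrib = ℤ-Solver.solve-∀

dot-mono : ∀ {n} (a : Fin n → ℕ) {x y : Point n} → (∀ i → x i ℤ.≤ y i) → dot a x ℤ.≤ dot a y
dot-mono {zero}  a h = ℤ.≤-refl
dot-mono {suc n} a h = ℤ.+-mono-≤ (ℤ.*-monoˡ-≤-nonNeg (+ a zero) (h zero)) (dot-mono (a ∘ suc) (h ∘ suc))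

∑-≥ : ∀ {n} (f : Cube n → ℕ) v → f v ℕ.≤ ∑ f
∑-≥ f []          = ≤-refl
∑-≥ f (true  ∷ v) = ≤-trans (∑-≥ (f ∘ (true ∷_)) v) (m≤m+n _ _)
∑-≥ f (false ∷ v) = ≤-trans (∑-≥ (f ∘ (false ∷_)) v) (m≤n+m _ _)

downward : ∀ {n} → (Fin n → ℕ) → Family n
downward a v = ⌊ dot a (vertex v) ℤ.<? + 0 ⌋

-- As the functional dot a + t xᵢ varies with t ≥ 0, it vanishes on v at t = − dot a v. Offering v there
-- moves between two maximisers, so the i-th coordinate of a maximiser grows by at least one.
module Sweep {n} (σ : ChooserStrategy (suc n)) (B : ℤ)
  (bounded : ∀ {z} → Reachable σ z → ∀ i → z i ℤ.≤ B)
  (a : Fin (suc n) → ℕ) (distinct : ∀ u v → dot a (vertex u) ≡ dot a (vertex v) → u ≡ v)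
  (i : Fin (suc n)) where

  φ : ℕ → Point (suc n) → ℤ
  φ t z = dot a z ℤ.+ + t ℤ.* z i

  Maximal : ℕ → Point (suc n) → Set
  Maximal t z = ∀ {x} → Reachable σ x → φ t x ℤ.≤ φ t z

  ¬¬maximal : ∀ t {z} → Reachable σ z → ¬ ¬ (∃[ x ] Reachable σ x × Maximal t x)
  ¬¬maximal t {z} r none = ¬¬maximum (λ (x : ∃[ z ] Reachable σ z) → φ t (proj₁ x)) (φ t (λ _ → B))
    (λ (x , rx) → ℤ.+-mono-≤ (dot-mono a (bounded rx)) (ℤ.*-monoˡ-≤-nonNeg (+ t) (bounded rx i))) (z , r)
    (λ ((x , rx) , max) → none (x , rx , λ {y} ry → max (y , ry)))

  φ-suc : ∀ t z → φ (suc t) z ≡ φ t z ℤ.+ z i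
  φ-suc t z = expand (dot a z) (+ t) (z i)
    where
    expand : ∀ d t x → d ℤ.+ (+ 1 ℤ.+ t) ℤ.* x ≡ (d ℤ.+ t ℤ.* x) ℤ.+ x
    expand = ℤ-Solver.solve-∀

  -- Adding the two maximality inequalities cancels the values of `φ t` and leaves the i-th
  -- coordinates: giving a coordinate more weight cannot lower it at a maximiser.
  maximal-monotone : ∀ {t x y} → Reachable σ x → Reachable σ y → Maximal t x → Maximal (suc t) y → x i ℤ.≤ y i
  maximal-monotone {t} {x} {y} rx ry max-x max-y = ℤ.≮⇒≥ λ yi<xi → ℤ.<-irrefl refl
    (ℤ.<-≤-trans (ℤ.+-mono-≤-< (max-x ry) yi<xi) (subst₂ ℤ._≤_ (φ-suc t x) (φ-suc t y) (max-y rx)))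

  φ-shift : ∀ t z b v → lookup v i ≡ true → φ t (vertex v) ≡ + 0 → φ t (shift z b v) ≡ φ t z
  φ-shift t z b v vi φv = begin
    dot a (shift z b v) ℤ.+ + t ℤ.* (z i ℤ.+ spin b ℤ.* vertex v i)
      ≡⟨ cong (ℤ._+ + t ℤ.* (z i ℤ.+ spin b ℤ.* vertex v i)) (dot-shift a z b v) ⟩
    (dot a z ℤ.+ spin b ℤ.* dot a (vertex v)) ℤ.+ + t ℤ.* (z i ℤ.+ spin b ℤ.* vertex v i)
      ≡⟨ regroup (dot a z) (spin b) (dot a (vertex v)) (+ t) (z i) (vertex v i) ⟩
    φ t z ℤ.+ spin b ℤ.* φ t (vertex v)
      ≡⟨ cong (λ x → φ t z ℤ.+ spin b ℤ.* x) φv ⟩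
    φ t z ℤ.+ spin b ℤ.* + 0
      ≡⟨ trans (cong (ℤ._+_ (φ t z)) (ℤ.*-zeroʳ (spin b))) (ℤ.+-identityʳ (φ t z)) ⟩
    φ t z ∎
    where
    regroup : ∀ d s e t z v → (d ℤ.+ s ℤ.* e) ℤ.+ t ℤ.* (z ℤ.+ s ℤ.* v) ≡ (d ℤ.+ t ℤ.* z) ℤ.+ s ℤ.* (e ℤ.+ t ℤ.* v)
    regroup = ℤ-Solver.solve-∀

  d : Cube (suc n) → ℤ
  d v = dot a (vertex v)

  -- These are the vectors with -t ≤ d v < 0. If such a vector contains `i`, the functional has
  -- changed from negative to nonnegative on it by time `t`.
  crossed : ℕ → Family (suc n)
  crossed t v = ⌊ d v ℤ.<? + 0 ⌋ ∧ ⌊ + 0 ℤ.≤? d v ℤ.+ + t ⌋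

  term : ℕ → Cube (suc n) → ℕ
  term t v = ⟦ crossed t v ⟧ * ⟦ lookup v i ⟧

  crossed-suc : ∀ t v → crossed t v ≢ crossed (suc t) v → d v ℤ.+ + suc t ≡ + 0
  crossed-suc t v differ with d v ℤ.<? + 0 | + 0 ℤ.≤? d v ℤ.+ + t | + 0 ℤ.≤? d v ℤ.+ + suc t
  ... | no  _ | _      | _      = contradiction refl differ
  ... | yes _ | yes _  | yes _  = contradiction refl differ
  ... | yes _ | no  _  | no  _  = contradiction refl differ
  ... | yes _ | yes 0≤ | no 0≰  = contradiction (ℤ.≤-trans 0≤ (ℤ.+-monoʳ-≤ (d v) (+≤+ (n≤1+n t)))) 0≰
  ... | yes _ | no 0≰  | yes 0≤ = ℤ.≤-antisym
    (subst (ℤ._≤ + 0) (assoc (d v) (+ t)) (ℤ.i<j⇒suc[i]≤j (ℤ.≰⇒> 0≰))) 0≤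
    where
    assoc : ∀ d t → + 1 ℤ.+ (d ℤ.+ t) ≡ d ℤ.+ (+ 1 ℤ.+ t)
    assoc = ℤ-Solver.solve-∀

  -- Since `d` is injective, at most one vector crosses at each integer time, so a gain of one per
  -- step keeps up with the count.
  crossed-once : ∀ t v → d v ℤ.+ + suc t ≡ + 0 → degree (crossed (suc t)) i ℕ.≤ suc (degree (crossed t) i)
  crossed-once t v dv = ≤-trans (m≤m+n _ _) (≤-trans
    (≤-reflexive (∑-differ {f = term (suc t)} {term t} v agree))
    (≤-trans (+-monoʳ-≤ (degree (crossed t) i) (unit (crossed (suc t) v) (lookup v i)))
      (≤-reflexive (+-comm (degree (crossed t) i) 1))))
    where
    unit : ∀ b c → ⟦ b ⟧ * ⟦ c ⟧ ℕ.≤ 1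
    unit true  true  = ≤-refl
    unit true  false = z≤n
    unit false c     = z≤n

    agree : ∀ u → u ≢ v → term (suc t) u ≡ term t u
    agree u u≢v = cong (λ b → ⟦ b ⟧ * ⟦ lookup u i ⟧) (sym (decidable-stable (crossed t u ≟ᵇ crossed (suc t) u)
      λ differ → u≢v (distinct u v (ℤ-cancelʳ (+ suc t) (d u) (d v) (trans (crossed-suc t u differ) (sym dv))))))

  module _ {z} (rz : Reachable σ z) (max-z : Maximal 0 z) where

    Ascent : ℕ → Set
    Ascent t = ∃[ y ] Reachable σ y × Maximal t y × z i ℤ.+ + degree (crossed t) i ℤ.≤ y i

    crossed-0 : degree (crossed 0) i ≡ 0
    crossed-0 = trans (∑-cong (λ v → cong (λ b → ⟦ b ⟧ * ⟦ lookup v i ⟧) (none v))) (∑-const (suc n) 0)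
      where
      none : ∀ v → crossed 0 v ≡ false
      none v with d v ℤ.<? + 0 | + 0 ℤ.≤? d v ℤ.+ + 0
      ... | no  _  | _      = refl
      ... | yes _  | no  _  = refl
      ... | yes d< | yes 0≤ = contradiction (subst (+ 0 ℤ.≤_) (ℤ.+-identityʳ (d v)) 0≤) (ℤ.<⇒≱ d<)

    -- At a crossing of `v`, the position before the offer and the position after it are both
    -- maximisers at time `suc t`, so neither has its i-th coordinate below that of the previous
    -- maximiser. These coordinates differ by one, so the larger of the two gains one whatever sign
    -- Chooser picks.
    ascend : ∀ t → Ascent t → ¬ ¬ Ascent (suc t)
    ascend t (x , rx , max-x , x≥) none = ¬¬maximal (suc t) rx λ (y , ry , max-y) →
      none (cases y ry max-y (degree (crossed t) i <? degree (crossed (suc t)) i))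
      where
      cases : ∀ y → Reachable σ y → Maximal (suc t) y → Dec (degree (crossed t) i < degree (crossed (suc t)) i) →
              Ascent (suc t)
      cases y ry max-y (no ≮) = y , ry , max-y ,
        ℤ.≤-trans (ℤ.+-monoʳ-≤ (z i) (+≤+ (≮⇒≥ ≮))) (ℤ.≤-trans x≥ (maximal-monotone {t} rx ry max-x max-y))
      cases y ry max-y (yes lt) = let (v , vlt) = ∑-<⇒∃ (term t) (term (suc t)) lt in at-crossing v vlt
        where
        gain : ∀ {v} → d v ℤ.+ + suc t ≡ + 0 → ∀ {w} → + 1 ℤ.+ x i ℤ.≤ w → z i ℤ.+ + degree (crossed (suc t)) i ℤ.≤ w
        gain {v} dv 1+x≤w = ℤ.≤-trans (ℤ.+-monoʳ-≤ (z i) (+≤+ (crossed-once t v dv)))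
          (ℤ.≤-trans (subst (ℤ._≤ + 1 ℤ.+ x i) (assoc (z i) (+ degree (crossed t) i)) (ℤ.+-monoʳ-≤ (+ 1) x≥)) 1+x≤w)
          where
          assoc : ∀ z c → + 1 ℤ.+ (z ℤ.+ c) ≡ z ℤ.+ (+ 1 ℤ.+ c)
          assoc = ℤ-Solver.solve-∀

        at-crossing : ∀ v → term t v < term (suc t) v → Ascent (suc t)
        at-crossing v vlt = respond (offer-vertex σ ry v)
          where
          vi : lookup v i ≡ true
          vi = bit (crossed t v) (crossed (suc t) v) (lookup v i) vlt
            where
            bit : ∀ p q b → ⟦ p ⟧ * ⟦ b ⟧ < ⟦ q ⟧ * ⟦ b ⟧ → b ≡ true
            bit p q true  _  = refl
            bit p q false lt = contradiction (subst₂ _<_ (*-zeroʳ ⟦ p ⟧) (*-zeroʳ ⟦ q ⟧) lt) λ ()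

          dv : d v ℤ.+ + suc t ≡ + 0
          dv = crossed-suc t v λ same → <-irrefl (cong (λ b → ⟦ b ⟧ * ⟦ lookup v i ⟧) same) vlt

          φv : φ (suc t) (vertex v) ≡ + 0
          φv = trans (cong (λ b → d v ℤ.+ + suc t ℤ.* spin b) vi)
            (trans (cong (ℤ._+_ (d v)) (ℤ.*-identityʳ (+ suc t))) dv)

          respond : ∃[ b ] Reachable σ (shift y b v) → Ascent (suc t)
          respond (b , ry′) = side b refl
            where
            y′ = shift y b v
            max-y′ : Maximal (suc t) y′
            max-y′ {w} rw = subst (φ (suc t) w ℤ.≤_) (sym (φ-shift (suc t) y b v vi φv)) (max-y rw)

            side : ∀ b′ → b ≡ b′ → Ascent (suc t)
            side true refl = y′ , ry′ , max-y′ , gain {v} dv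
              (subst (+ 1 ℤ.+ x i ℤ.≤_) (trans (ℤ.+-comm (+ 1) (y i)) (cong (λ c → y i ℤ.+ + 1 ℤ.* spin c) (sym vi)))
                (ℤ.+-monoʳ-≤ (+ 1) (maximal-monotone {t} rx ry max-x max-y)))
            -- When Chooser subtracts `v`, the position `y` before the offer is kept; the lower
            -- position `y′` serves only to show that `y` lies one above the previous maximiser.
            side false refl = y , ry , max-y , gain {v} dv
              (subst (+ 1 ℤ.+ x i ℤ.≤_) (trans (cong (λ c → + 1 ℤ.+ (y i ℤ.+ (ℤ.- (+ 1)) ℤ.* spin c)) vi) (cancel (y i)))
                (ℤ.+-monoʳ-≤ (+ 1) (maximal-monotone {t} rx ry′ max-x max-y′)))
              where
              cancel : ∀ y → + 1 ℤ.+ (y ℤ.+ (ℤ.- (+ 1)) ℤ.* + 1) ≡ y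
              cancel = ℤ-Solver.solve-∀

    ¬¬ascent : ∀ t → ¬ ¬ Ascent t
    ¬¬ascent zero    none = none (z , rz , max-z ,
      ℤ.≤-reflexive (trans (cong (λ c → z i ℤ.+ + c) crossed-0) (ℤ.+-identityʳ (z i))))
    ¬¬ascent (suc t) none = ¬¬ascent t λ asc → ascend t asc none

    ¬¬high : ¬ ¬ (∃[ y ] Reachable σ y × z i ℤ.+ + degree (downward a) i ℤ.≤ y i)
    ¬¬high none = ¬¬ascent horizon λ (y , ry , _ , y≥) →
      none (y , ry , subst (λ c → z i ℤ.+ + c ℤ.≤ y i) all-crossed y≥)
      where
      -- A time that is at least every absolute value of `d`, so that all downward vectors have
      -- crossed.
      horizon = ∑ (λ v → ∣ d v ∣)

      0≤d+horizon : ∀ v → + 0 ℤ.≤ d v ℤ.+ + horizon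
      0≤d+horizon v = ℤ.≤-trans (nonneg (d v)) (ℤ.+-monoʳ-≤ (d v) (+≤+ (∑-≥ (λ v → ∣ d v ∣) v)))
        where
        nonneg : ∀ x → + 0 ℤ.≤ x ℤ.+ + ∣ x ∣
        nonneg (+ k)    = +≤+ z≤n
        nonneg -[1+ k ] = ℤ.≤-reflexive (sym (ℤ.n⊖n≡0 (suc k)))

      all-crossed : degree (crossed horizon) i ≡ degree (downward a) i
      all-crossed = ∑-cong (λ v → cong (λ b → ⟦ b ⟧ * ⟦ lookup v i ⟧) (crossed-v v))
        where
        crossed-v : ∀ v → crossed horizon v ≡ downward a v
        crossed-v v with + 0 ℤ.≤? d v ℤ.+ + horizon
        ... | yes _  = ∧-identityʳ _
        ... | no  0≰ = contradiction (0≤d+horizon v) 0≰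

-- A functional that separates the vertices

dot-+ : ∀ {n} (a : Fin n → ℕ) x y → dot a (λ i → x i ℤ.+ y i) ≡ dot a x ℤ.+ dot a y
dot-+ a x y = trans (Σℤ.sum-cong-≗ (λ i → ℤ.*-distribˡ-+ (+ a i) (x i) (y i)))
  (Σℤ.∑-distrib-+ (λ i → + a i ℤ.* x i) (λ i → + a i ℤ.* y i))

dot-pos : ∀ {n} (a f : Fin n → ℕ) → dot a (λ i → + f i) ≡ + Σℕ.sum (λ i → a i * f i)
dot-pos {zero}  a f = refl
dot-pos {suc n} a f = begin
  + a zero ℤ.* + f zero ℤ.+ dot (a ∘ suc) (λ i → + f (suc i))
    ≡⟨ cong₂ ℤ._+_ (sym (ℤ.pos-* (a zero) (f zero))) (dot-pos (a ∘ suc) (f ∘ suc)) ⟩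
  + (a zero * f zero) ℤ.+ + Σℕ.sum (λ i → a (suc i) * f (suc i))
    ≡⟨ ℤ.pos-+ (a zero * f zero) _ ⟨
  + Σℕ.sum (λ i → a i * f i) ∎

weight : ∀ {n} → (Fin n → ℕ) → Cube n → ℕ
weight a v = Σℕ.sum (λ i → a i * ⟦ lookup v i ⟧)

dot-vertex : ∀ {n} (a : Fin n → ℕ) v → dot a (vertex v) ℤ.+ + weight a (compl v) ≡ + weight a v
dot-vertex a v = begin
  dot a (vertex v) ℤ.+ + weight a (compl v)
    ≡⟨ cong (ℤ._+_ (dot a (vertex v))) (dot-pos a (λ i → ⟦ lookup (compl v) i ⟧)) ⟨
  dot a (vertex v) ℤ.+ dot a (λ i → + ⟦ lookup (compl v) i ⟧)
    ≡⟨ dot-+ a (vertex v) (λ i → + ⟦ lookup (compl v) i ⟧) ⟨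
  dot a (λ i → vertex v i ℤ.+ + ⟦ lookup (compl v) i ⟧)
    ≡⟨ Σℤ.sum-cong-≗ (λ i → cong (ℤ._*_ (+ a i)) (trans
        (cong (λ b → vertex v i ℤ.+ + ⟦ b ⟧) (lookup-compl v i)) (spin+ (lookup v i)))) ⟩
  dot a (λ i → + ⟦ lookup v i ⟧)
    ≡⟨ dot-pos a (λ i → ⟦ lookup v i ⟧) ⟩
  + weight a v ∎
  where
  spin+ : ∀ b → spin b ℤ.+ + ⟦ not b ⟧ ≡ + ⟦ b ⟧
  spin+ true  = refl
  spin+ false = refl

weight-compl : ∀ {n} (a : Fin n → ℕ) v → weight a (compl v) + weight a v ≡ Σℕ.sum a
weight-compl a v = trans
  (sym (Σℕ.∑-distrib-+ (λ i → a i * ⟦ lookup (compl v) i ⟧) (λ i → a i * ⟦ lookup v i ⟧)))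
  (Σℕ.sum-cong-≗ (λ i → trans (sym (*-distribˡ-+ (a i) ⟦ lookup (compl v) i ⟧ ⟦ lookup v i ⟧))
    (trans (cong (a i *_) (trans (cong (λ b → ⟦ b ⟧ + ⟦ lookup v i ⟧) (lookup-compl v i)) (one (lookup v i))))
      (*-identityʳ (a i)))))
  where
  one : ∀ b → ⟦ not b ⟧ + ⟦ b ⟧ ≡ 1
  one true  = refl
  one false = refl

double-injective : ∀ {x y} → x + x ≡ y + y → x ≡ y
double-injective {x} {y} e = *-cancelˡ-≡ x y 2 (trans (cong (λ k → x + k) (+-identityʳ x)) (trans e (cong (λ k → y + k) (sym (+-identityʳ y)))))

-- The value on a vertex is twice its weight minus the sum of all coefficients, so coincidences of
-- values are coincidences of weights.
dot-vertex⇒weight : ∀ {n} (a : Fin n → ℕ) u v → dot a (vertex u) ≡ dot a (vertex v) → weight a u ≡ weight a v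
dot-vertex⇒weight a u v e = double-injective (ℤ.+-injective (trans (twice u) (trans (cong (ℤ._+ + Σℕ.sum a) e) (sym (twice v)))))
  where
  twice : ∀ v → + (weight a v + weight a v) ≡ dot a (vertex v) ℤ.+ + Σℕ.sum a
  twice v = begin
    + (weight a v + weight a v)
      ≡⟨ ℤ.pos-+ (weight a v) (weight a v) ⟩
    + weight a v ℤ.+ + weight a v
      ≡⟨ cong (ℤ._+ + weight a v) (dot-vertex a v) ⟨
    dot a (vertex v) ℤ.+ + weight a (compl v) ℤ.+ + weight a v
      ≡⟨ ℤ.+-assoc (dot a (vertex v)) _ _ ⟩
    dot a (vertex v) ℤ.+ (+ weight a (compl v) ℤ.+ + weight a v)
      ≡⟨ cong (ℤ._+_ (dot a (vertex v))) (trans (sym (ℤ.pos-+ (weight a (compl v)) (weight a v))) (cong +_ (weight-compl a v))) ⟩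
    dot a (vertex v) ℤ.+ + Σℕ.sum a ∎

binary : ∀ {n} → Fin n → ℕ
binary i = 2 ^ toℕ i

weight-binary-∷ : ∀ {n} b (v : Cube n) → weight binary (b ∷ v) ≡ ⟦ b ⟧ + 2 * weight binary v
weight-binary-∷ b v = cong₂ _+_ (+-identityʳ ⟦ b ⟧) (trans
  (Σℕ.sum-cong-≗ (λ i → *-assoc 2 (binary i) ⟦ lookup v i ⟧))
  (sym (Σℕ.*-distribˡ-sum 2 (λ i → binary i * ⟦ lookup v i ⟧))))

weight-binary-injective : ∀ {n} (u v : Cube n) → weight binary u ≡ weight binary v → u ≡ v
weight-binary-injective []      []      e = refl
weight-binary-injective (b ∷ u) (c ∷ v) e =
  bits b c (trans (sym (weight-binary-∷ b u)) (trans e (weight-binary-∷ c v)))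
  where
  tails : 2 * weight binary u ≡ 2 * weight binary v → u ≡ v
  tails e = weight-binary-injective u v (*-cancelˡ-≡ _ _ 2 e)
  bits : ∀ b c → ⟦ b ⟧ + 2 * weight binary u ≡ ⟦ c ⟧ + 2 * weight binary v → b ∷ u ≡ c ∷ v
  bits true  true  e = cong (true ∷_) (tails (suc-injective e))
  bits false false e = cong (false ∷_) (tails e)
  bits true  false e = contradiction (sym e) (even≢odd (weight binary v) (weight binary u))
  bits false true  e = contradiction e (even≢odd (weight binary u) (weight binary v))

-- The functional sums all coordinates up to a perturbation: large L makes it decrease only along light vectors,
-- and the binary digits make its values on the vertices distinct.
module Perturbed {p} (L : ℕ) (L> : Σℕ.sum {suc p} binary < L) where

  a : Fin (suc p) → ℕ
  a i = L + binary i

  weight-a : ∀ v → weight a v ≡ L * ones v + weight binary v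
  weight-a v = begin
    weight a v
      ≡⟨ Σℕ.sum-cong-≗ (λ i → *-distribʳ-+ ⟦ lookup v i ⟧ L (binary i)) ⟩
    Σℕ.sum (λ i → L * ⟦ lookup v i ⟧ + binary i * ⟦ lookup v i ⟧)
      ≡⟨ Σℕ.∑-distrib-+ (λ i → L * ⟦ lookup v i ⟧) (λ i → binary i * ⟦ lookup v i ⟧) ⟩
    Σℕ.sum (λ i → L * ⟦ lookup v i ⟧) + weight binary v
      ≡⟨ cong (_+ weight binary v) (trans (sym (Σℕ.*-distribˡ-sum L (λ i → ⟦ lookup v i ⟧))) (cong (L *_) (∑Fin-lookup v))) ⟩
    L * ones v + weight binary v ∎

  weight-mono : ∀ u v → ones u < ones v → weight a u < weight a v
  weight-mono u v lt = subst₂ _<_ (sym (weight-a u)) (sym (weight-a v)) (R.begin-strict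
    L * ones u + weight binary u R.<⟨ +-monoʳ-< (L * ones u) (≤-<-trans (Fin-sum-mono (λ i → below (binary i) (lookup u i))) L>) ⟩
    L * ones u + L               R.≡⟨ +-comm (L * ones u) L ⟩
    L + L * ones u               R.≡⟨ *-suc L (ones u) ⟨
    L * suc (ones u)             R.≤⟨ *-monoʳ-≤ L lt ⟩
    L * ones v                   R.≤⟨ m≤m+n (L * ones v) (weight binary v) ⟩
    L * ones v + weight binary v R.∎)
    where
    module R = ≤-Reasoning
    below : ∀ x b → x * ⟦ b ⟧ ℕ.≤ x
    below x true  = ≤-reflexive (*-identityʳ x)
    below x false = ≤-trans (≤-reflexive (*-zeroʳ x)) z≤n

  distinct : ∀ u v → dot a (vertex u) ≡ dot a (vertex v) → u ≡ v
  distinct u v e = weight-binary-injective u v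
    (+-cancelˡ-≡ (L * ones u) _ _ (trans (sym (weight-a u)) (trans same (trans (weight-a v) (cong (λ k → L * k + weight binary v) (sym same-ones))))))
    where
    same : weight a u ≡ weight a v
    same = dot-vertex⇒weight a u v e
    same-ones : ones u ≡ ones v
    same-ones with <-cmp (ones u) (ones v)
    ... | tri< lt _ _ = contradiction same (<⇒≢ (weight-mono u v lt))
    ... | tri≈ _ eq _ = eq
    ... | tri> _ _ gt = contradiction (sym same) (<⇒≢ (weight-mono v u gt))

  dot-compl : ∀ v → dot a (vertex (compl v)) ≡ ℤ.- dot a (vertex v)
  dot-compl v = begin
    dot a (vertex (compl v))
      ≡⟨ difference (trans (cong (λ w → dot a (vertex (compl v)) ℤ.+ + weight a w) (sym (compl-involutive v))) (dot-vertex a (compl v))) ⟩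
    + weight a (compl v) ℤ.- + weight a v
      ≡⟨ negate (+ weight a v) (+ weight a (compl v)) ⟨
    ℤ.- (+ weight a v ℤ.- + weight a (compl v))
      ≡⟨ cong ℤ.-_ (difference (dot-vertex a v)) ⟨
    ℤ.- dot a (vertex v) ∎
    where
    difference : ∀ {x y z} → x ℤ.+ y ≡ z → x ≡ z ℤ.- y
    difference {x} {y} refl = expand x y
      where
      expand : ∀ x y → x ≡ (x ℤ.+ y) ℤ.- y
      expand = ℤ-Solver.solve-∀
    negate : ∀ x y → ℤ.- (x ℤ.- y) ≡ y ℤ.- x
    negate = ℤ-Solver.solve-∀

  -- Complements have opposite values, so a zero would be shared by a vector and its complement,
  -- against distinctness. Thus the sign decides every pair, including the balanced ones.
  dot-vertex≢0 : ∀ v → dot a (vertex v) ≢ + 0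
  dot-vertex≢0 v@(b ∷ _) d≡0 = not≢ b (cong head (distinct (compl v) v (trans (dot-compl v) (trans (cong ℤ.-_ d≡0) (sym d≡0)))))
    where
    not≢ : ∀ b → not b ≢ b
    not≢ true  ()
    not≢ false ()

  downward-selection : Selection (downward a)
  downward-selection v = sign (dot-compl v) (dot-vertex≢0 v)
    where
    sign : ∀ {x y} → x ≡ ℤ.- y → y ≢ + 0 → ⌊ x ℤ.<? + 0 ⌋ ≡ not ⌊ y ℤ.<? + 0 ⌋
    sign {y = + zero}   refl ≢0 = contradiction refl ≢0
    sign {y = + suc y}  refl ≢0 = refl
    sign {y = -[1+ y ]} refl ≢0 = refl

  downward-light : Light (downward a)
  downward-light v e with dot a (vertex v) ℤ.<? + 0
  ... | yes d<0 = ≮⇒≥ λ zeros<ones → ℤ.<-asym (ℤ.+<+ (weight-mono (compl v) v zeros<ones))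
    (subst₂ ℤ._<_ (dot-vertex a v) (ℤ.+-identityˡ _) (ℤ.+-monoˡ-< (+ weight a (compl v)) d<0))

-- One maximiser `z` of the functional serves as the start of the sweeps for all `i`, each giving zᵢ
-- + Nᵢ + 1 ≤ c. Since the origin is reachable, the functional is nonnegative at `z`, so weighting
-- these inequalities by `a` eliminates `z` and bounds the degrees alone.
pusher-reaches : ∀ p c → 2 * c + midBinomial (suc p) ℕ.≤ suc (2 ^ p) → (σ : ChooserStrategy (suc p)) →
                 ¬ (∀ {z} → Reachable σ z → ∀ i → z i ℤ.< + c)
pusher-reaches p c 2c+b≤ σ below =
  ¬¬maximum (λ (x : ∃[ z ] Reachable σ z) → dot a (proj₁ x)) (dot a (λ _ → + c)) (λ (_ , r) → dot-mono a (bounded r))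
    (origin , start) λ ((z , rz) , max-z) → absurd rz (λ rx → max-z (_ , rx))
  where
  W = Σℕ.sum {suc p} binary
  -- The final count leaves a surplus of `n * L` against an error of `2 * (W * c)` caused by the
  -- binary digits; the summand `W` ensures that size outweighs all digits together.
  L = suc (2 * (W * c) + W)
  n = suc p
  b = midBinomial n

  open Perturbed {p} L (s≤s (m≤n+m W (2 * (W * c))))

  bounded : ∀ {z} → Reachable σ z → ∀ i → z i ℤ.≤ + c
  bounded r i = ℤ.<⇒≤ (below r i)

  start : Reachable σ origin
  start = record { offers = λ _ → vertex (true ∷ replicate p true); valid = λ _ → vertex∈V _; round = 0; at = λ _ → refl }

  N : Fin n → ℕ
  N = degree (downward a)
  S = Σℕ.sum N

  module _ {z} (rz : Reachable σ z) (max-z : ∀ {x} → Reachable σ x → dot a x ℤ.≤ dot a z) where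

    low : ∀ i → z i ℤ.+ + suc (N i) ℤ.≤ + c
    low i = decidable-stable (z i ℤ.+ + suc (N i) ℤ.≤? + c) λ high → ¬¬high rz max-z′ λ (y , ry , y≥) → high
      (ℤ.≤-trans (ℤ.≤-reflexive (assoc (z i) (+ N i))) (ℤ.i<j⇒suc[i]≤j (ℤ.≤-<-trans y≥ (below ry i))))
      where
      open Sweep σ (+ c) bounded a distinct i
      assoc : ∀ z n → z ℤ.+ (+ 1 ℤ.+ n) ≡ + 1 ℤ.+ (z ℤ.+ n)
      assoc = ℤ-Solver.solve-∀
      φ-zero : ∀ x → φ 0 x ≡ dot a x
      φ-zero x = ℤ.+-identityʳ (dot a x)
      max-z′ : Maximal 0 z
      max-z′ {x} rx = subst₂ ℤ._≤_ (sym (φ-zero x)) (sym (φ-zero z)) (max-z rx)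

    dot-origin : dot a origin ≡ + 0
    dot-origin = trans (dot-pos a (λ _ → 0)) (cong +_ (trans (Σℕ.sum-cong-≗ (λ i → *-zeroʳ (a i)))
      (trans (Fin-sum-const n 0) (*-zeroʳ n))))

    averaged : Σℕ.sum (λ i → a i * suc (N i)) ℕ.≤ Σℕ.sum (λ i → a i * c)
    averaged = ℤ.drop‿+≤+ (subst₂ ℤ._≤_ (ℤ.+-identityˡ _) (dot-pos a (λ _ → c))
      (ℤ.≤-trans (ℤ.+-monoˡ-≤ (+ Σℕ.sum (λ i → a i * suc (N i))) (subst (ℤ._≤ dot a z) dot-origin (max-z start)))
        (subst (ℤ._≤ dot a (λ _ → + c))
          (trans (dot-+ a z (λ i → + suc (N i))) (cong (ℤ._+_ (dot a z)) (dot-pos a (λ i → suc (N i)))))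
          (dot-mono a low))))

    lower : L * (n + S) ℕ.≤ Σℕ.sum (λ i → a i * suc (N i))
    lower = ≤-trans (≤-reflexive (trans (cong (L *_) (sym sum-suc)) (Σℕ.*-distribˡ-sum L (λ i → suc (N i)))))
      (Fin-sum-mono (λ i → *-monoˡ-≤ (suc (N i)) (m≤m+n L (binary i))))
      where
      sum-suc : Σℕ.sum (λ i → suc (N i)) ≡ n + S
      sum-suc = trans (Σℕ.∑-distrib-+ (λ _ → 1) N) (cong (_+ S) (trans (Fin-sum-const n 1) (*-identityʳ n)))

    upper : Σℕ.sum (λ i → a i * c) ≡ n * L * c + W * c
    upper = trans (sym (Σℕ.*-distribʳ-sum c a)) (trans
      (cong (_* c) (trans (Σℕ.∑-distrib-+ {n} (λ _ → L) binary) (cong (_+ W) (Fin-sum-const n L))))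
      (*-distribʳ-+ c (n * L) W))

    absurd : ⊥
    absurd = <-irrefl refl (R.begin-strict
      L                R.≤⟨ m≤n*m L n ⟩
      n * L            R.≤⟨ +-cancelʳ-≤ (n * L * suc (2 ^ p)) (n * L) (2 * (W * c)) chain ⟩
      2 * (W * c)      R.<⟨ s≤s (m≤m+n (2 * (W * c)) W) ⟩
      L                R.∎)
      where
      module R = ≤-Reasoning
      expand : ∀ n L q → n * L + n * L * suc q ≡ 2 * (L * n) + L * (n * q)
      expand = solve-∀
      collect : ∀ n L s b → 2 * (L * n) + L * (2 * s + n * b) ≡ 2 * (L * (n + s)) + n * L * b
      collect = solve-∀
      factor : ∀ n L c b w → 2 * (n * L * c + w) + n * L * b ≡ 2 * w + n * L * (2 * c + b)
      factor = solve-∀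
      chain : n * L + n * L * suc (2 ^ p) ℕ.≤ 2 * (W * c) + n * L * suc (2 ^ p)
      chain = R.begin
        n * L + n * L * suc (2 ^ p)           R.≡⟨ expand n L (2 ^ p) ⟩
        2 * (L * n) + L * (n * 2 ^ p)         R.≡⟨ cong (λ x → 2 * (L * n) + L * x) (∑Fin-degree-light downward-selection downward-light) ⟨
        2 * (L * n) + L * (2 * S + n * b)     R.≡⟨ collect n L S b ⟩
        2 * (L * (n + S)) + n * L * b         R.≤⟨ +-monoˡ-≤ (n * L * b) (*-monoʳ-≤ 2 (≤-trans lower (≤-trans averaged (≤-reflexive upper)))) ⟩
        2 * (n * L * c + W * c) + n * L * b   R.≡⟨ factor n L c b (W * c) ⟩
        2 * (W * c) + n * L * (2 * c + b)     R.≤⟨ +-monoʳ-≤ (2 * (W * c)) (*-monoʳ-≤ (n * L) 2c+b≤) ⟩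
        2 * (W * c) + n * L * suc (2 ^ p)     R.∎

-- Critical values

import Data.Rational as ℚ
open import Data.Rational using (½)
import Data.Rational.Properties as ℚ
open import Data.Rational.Solver using (module +-*-Solver)
open import Data.Rational.Unnormalised as ℚᵘ using (mkℚᵘ)
import Data.Rational.Unnormalised.Properties as ℚᵘ

toℚ-≃ : ∀ z → ℚ.toℚᵘ (toℚ z) ℚᵘ.≃ mkℚᵘ z 0
toℚ-≃ z = ℚ.toℚᵘ-fromℚᵘ (mkℚᵘ z 0)

toℚ-mono : ∀ {x y} → x ℤ.≤ y → toℚ x ≤ toℚ y
toℚ-mono {x} {y} x≤y = ℚ.toℚᵘ-cancel-≤ (ℚᵘ.≤-respˡ-≃ (ℚᵘ.≃-sym (toℚ-≃ x)) (ℚᵘ.≤-respʳ-≃ (ℚᵘ.≃-sym (toℚ-≃ y))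
  (ℚᵘ.*≤* (ℤ.*-monoʳ-≤-nonNeg (+ 1) x≤y))))

ℕtoℚ-+ : ∀ x y → ℕtoℚ (x + y) ≡ ℕtoℚ x ℚ.+ ℕtoℚ y
ℕtoℚ-+ x y = ℚ.toℚᵘ-injective (ℚᵘ.≃-trans (toℚ-≃ (+ (x + y))) (ℚᵘ.≃-sym (ℚᵘ.≃-trans
  (ℚ.toℚᵘ-homo-+ (ℕtoℚ x) (ℕtoℚ y))
  (ℚᵘ.≃-trans (ℚᵘ.+-cong (toℚ-≃ (+ x)) (toℚ-≃ (+ y)))
    (ℚᵘ.*≡* (cong (ℤ._* + 1) (trans (cong₂ ℤ._+_ (ℤ.*-identityʳ (+ x)) (ℤ.*-identityʳ (+ y))) (sym (ℤ.pos-+ x y)))))))))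

ℕtoℚ-* : ∀ x y → ℕtoℚ (x * y) ≡ ℕtoℚ x ℚ.* ℕtoℚ y
ℕtoℚ-* x y = ℚ.toℚᵘ-injective (ℚᵘ.≃-trans (toℚ-≃ (+ (x * y))) (ℚᵘ.≃-sym (ℚᵘ.≃-trans
  (ℚ.toℚᵘ-homo-* (ℕtoℚ x) (ℕtoℚ y))
  (ℚᵘ.≃-trans (ℚᵘ.*-cong (toℚ-≃ (+ x)) (toℚ-≃ (+ y)))
    (ℚᵘ.*≡* (cong (ℤ._* + 1) (sym (ℤ.pos-* x y))))))))

-- The two inequalities make `c` the ceiling of 2ⁿ⁻² - b/2 with n = q + 2. If `c` exceeded `M`,
-- every reachable coordinate, being an integer at most `M`, would be below `c`; decidability of the
-- order on ℚ removes the double negation.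
chooser-wins⇔ : ∀ q c M → 2 ^ suc q ℕ.≤ 2 * c + midBinomial (2 + q) → 2 * c + midBinomial (2 + q) ℕ.≤ suc (2 ^ suc q) →
                ChooserWins (Vset (2 + q)) (KM (2 + q) M) ⇔ (ℕtoℚ c ≤ M)
chooser-wins⇔ q c M ≥2^ ≤2^ = mk⇔ to from
  where
  to : ChooserWins (Vset (2 + q)) (KM (2 + q) M) → ℕtoℚ c ≤ M
  to (σ , wins) = decidable-stable (ℕtoℚ c ℚ.≤? M) λ c≰M → pusher-reaches (suc q) c ≤2^ σ λ r i → ℤ.≰⇒> λ c≤z →
    c≰M (ℚ.≤-trans (toℚ-mono c≤z) (subst (λ x → toℚ x ≤ M) (Reachable.at r i)
      (wins (Reachable.offers r) (Reachable.valid r) (Reachable.round r) i)))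

  from : ℕtoℚ c ≤ M → ChooserWins (Vset (2 + q)) (KM (2 + q) M)
  from c≤M with chooser-keeps-below q c ≥2^
  ... | σ , keeps = σ , λ offers valid k i → ℚ.≤-trans (toℚ-mono (keeps offers valid k i)) c≤M

-- Here `deficit` is ⌊b/2⌋, so `value` is 2ⁿ⁻² - b/2 rounded up; the odd alternative of `rounding`
-- accounts for the additional ½ at powers of two.
record Threshold (n : ℕ) (t : ℚ) : Set where
  field
    value deficit : ℕ
    value+deficit : value + deficit ≡ 2 ^ (n ∸ 2)
    rounding      : midBinomial n ≡ deficit + deficit ⊎ midBinomial n ≡ suc (deficit + deficit)
    t≡value       : t ≡ ℕtoℚ value

threshold-wins : ∀ {n t} → 1 < n → Threshold n t → ∀ M → ChooserWins (Vset n) (KM n M) ⇔ t ≤ M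
threshold-wins {suc zero}    (s≤s ())
threshold-wins {suc (suc q)} _ th M = subst (λ x → ChooserWins (Vset (2 + q)) (KM (2 + q) M) ⇔ x ≤ M) (sym t≡value)
  (chooser-wins⇔ q value M (bounds .proj₁) (bounds .proj₂))
  where
  open Threshold th
  expand : ∀ c h → 2 * c + (h + h) ≡ 2 * (c + h)
  expand = solve-∀
  expand′ : ∀ c h → 2 * c + suc (h + h) ≡ suc (2 * (c + h))
  expand′ = solve-∀
  bounds : 2 ^ suc q ℕ.≤ 2 * value + midBinomial (2 + q) × 2 * value + midBinomial (2 + q) ℕ.≤ suc (2 ^ suc q)
  bounds with rounding
  ... | inj₁ even = ≤-reflexive (sym e) , ≤-trans (≤-reflexive e) (n≤1+n _)
    where
    e : 2 * value + midBinomial (2 + q) ≡ 2 ^ suc q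
    e = trans (cong (2 * value ℕ.+_) even) (trans (expand value deficit) (cong (2 *_) value+deficit))
  ... | inj₂ odd  = ≤-trans (n≤1+n _) (≤-reflexive (sym e)) , ≤-reflexive e
    where
    e : 2 * value + midBinomial (2 + q) ≡ suc (2 ^ suc q)
    e = trans (cong (2 * value ℕ.+_) odd) (trans (expand′ value deficit) (cong (λ x → suc (2 * x)) value+deficit))

-- As h is at most b/2, the estimate n·b² ≤ 4ⁿ⁻¹ becomes n·h² ≤ (2ⁿ⁻²)², which is the asymptotic
-- claim with constant 1.
deficit-bound : ∀ q h → h + h ℕ.≤ midBinomial (2 + q) → (2 + q) * (h * h) ℕ.≤ 2 ^ q * 2 ^ q
deficit-bound q h 2h≤b = *-cancelˡ-≤ 4 (R.begin
  4 * ((2 + q) * (h * h))       R.≡⟨ square (2 + q) h ⟩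
  (2 + q) * ((h + h) * (h + h)) R.≤⟨ *-monoʳ-≤ (2 + q) (*-mono-≤ 2h≤b 2h≤b) ⟩
  (2 + q) * (b * b)             R.≤⟨ midBinomial-bound (suc q) ⟩
  4 ^ suc q                     R.≡⟨ cong (4 *_) (trans (^-*-assoc 2 2 q) (trans (cong (λ k → 2 ^ (q ℕ.+ k)) (+-identityʳ q)) (^-distribˡ-+-* 2 q q))) ⟩
  4 * (2 ^ q * 2 ^ q)           R.∎)
  where
  module R = ≤-Reasoning
  b = midBinomial (2 + q)
  square : ∀ n h → 4 * (n * (h * h)) ≡ n * ((h + h) * (h + h))
  square = solve-∀

-- This makes the truncated subtraction that defines the critical integer exact.
deficit≤ : ∀ q h → h + h ℕ.≤ midBinomial (2 + q) → h ℕ.≤ 2 ^ q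
deficit≤ q h 2h≤b = ≮⇒≥ λ lt → <-irrefl refl (≤-<-trans
  (≤-trans (m≤n*m (h * h) (2 + q)) (deficit-bound q h 2h≤b)) (*-mono-< lt lt))

threshold-asymptotics : ∀ {n t} → 1 < n → Threshold n t → AsymBound 1 n t
threshold-asymptotics {suc zero}        (s≤s ())
threshold-asymptotics {suc (suc q)} {t} _ th = subst₂ _≤_ lhs rhs (toℚ-mono (+≤+ (deficit-bound q deficit 2d≤b)))
  where
  open Threshold th
  P = ℕtoℚ (2 ^ q)
  2d≤b : deficit + deficit ℕ.≤ midBinomial (2 + q)
  2d≤b with rounding
  ... | inj₁ even = ≤-reflexive (sym even)
  ... | inj₂ odd  = ≤-trans (n≤1+n _) (≤-reflexive (sym odd))

  gap : P ℚ.- t ≡ ℕtoℚ deficit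
  gap = begin
    P ℚ.- t                                         ≡⟨ cong₂ ℚ._-_ (trans (cong ℕtoℚ (sym value+deficit)) (ℕtoℚ-+ value deficit)) t≡value ⟩
    (ℕtoℚ value ℚ.+ ℕtoℚ deficit) ℚ.- ℕtoℚ value    ≡⟨ solve 2 (λ x y → (x :+ y) :- x := y) refl (ℕtoℚ value) (ℕtoℚ deficit) ⟩
    ℕtoℚ deficit                                    ∎
    where open +-*-Solver

  lhs : ℕtoℚ ((2 + q) * (deficit * deficit)) ≡ ℕtoℚ (2 + q) ℚ.* ((P ℚ.- t) ℚ.* (P ℚ.- t))
  lhs = trans (ℕtoℚ-* (2 + q) (deficit * deficit)) (cong (ℕtoℚ (2 + q) ℚ.*_)
    (trans (ℕtoℚ-* deficit deficit) (sym (cong₂ ℚ._*_ gap gap))))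

  rhs : ℕtoℚ (2 ^ q * 2 ^ q) ≡ ℕtoℚ 1 ℚ.* (P ℚ.* P)
  rhs = trans (ℕtoℚ-* (2 ^ q) (2 ^ q)) (sym (ℚ.*-identityˡ (P ℚ.* P)))

threshold-even : ∀ n → 1 < n → parity (midBinomial n) ≡ 0ℙ → Threshold n (critEven n)
threshold-even (suc (suc q)) (s≤s _) par = record
  { value = c; deficit = h; value+deficit = c+h; rounding = inj₁ b≡; t≡value = begin
      ℕtoℚ (2 ^ q) ℚ.- ½ ℚ.* ℕtoℚ (midBinomial (2 + q))
        ≡⟨ cong₂ (λ x y → x ℚ.- ½ ℚ.* y) (trans (cong ℕtoℚ (sym c+h)) (ℕtoℚ-+ c h)) (trans (cong ℕtoℚ b≡) (ℕtoℚ-+ h h)) ⟩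
      (ℕtoℚ c ℚ.+ ℕtoℚ h) ℚ.- ½ ℚ.* (ℕtoℚ h ℚ.+ ℕtoℚ h)
        ≡⟨ solve 2 (λ x y → (x :+ y) :- con ½ :* (y :+ y) := x) refl (ℕtoℚ c) (ℕtoℚ h) ⟩
      ℕtoℚ c ∎ }
  where
  open +-*-Solver
  half = parity-0 (midBinomial (2 + q)) par
  h = half .proj₁
  b≡ = half .proj₂
  c = 2 ^ q ∸ h
  c+h : c + h ≡ 2 ^ q
  c+h = m∸n+n≡m (deficit≤ q h (≤-reflexive (sym b≡)))

threshold-pow2 : ∀ n → 1 < n → parity (midBinomial n) ≡ 1ℙ → Threshold n (critPow2 n)
threshold-pow2 (suc (suc q)) (s≤s _) par = record
  { value = c; deficit = h; value+deficit = c+h; rounding = inj₂ b≡; t≡value = begin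
      (ℕtoℚ (2 ^ q) ℚ.- ½ ℚ.* ℕtoℚ (midBinomial (2 + q))) ℚ.+ ½
        ≡⟨ cong₂ (λ x y → (x ℚ.- ½ ℚ.* y) ℚ.+ ½) (trans (cong ℕtoℚ (sym c+h)) (ℕtoℚ-+ c h))
             (trans (cong ℕtoℚ b≡) (trans (ℕtoℚ-+ 1 (h + h)) (cong (ℕtoℚ 1 ℚ.+_) (ℕtoℚ-+ h h)))) ⟩
      ((ℕtoℚ c ℚ.+ ℕtoℚ h) ℚ.- ½ ℚ.* (ℕtoℚ 1 ℚ.+ (ℕtoℚ h ℚ.+ ℕtoℚ h))) ℚ.+ ½
        ≡⟨ solve 2 (λ x y → ((x :+ y) :- con ½ :* (con ℚ.1ℚ :+ (y :+ y))) :+ con ½ := x) refl (ℕtoℚ c) (ℕtoℚ h) ⟩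
      ℕtoℚ c ∎ }
  where
  open +-*-Solver
  half = parity-1 (midBinomial (2 + q)) par
  h = half .proj₁
  b≡ = half .proj₂
  c = 2 ^ q ∸ h
  c+h : c + h ≡ 2 ^ q
  c+h = m∸n+n≡m (deficit≤ q h (≤-trans (n≤1+n _) (≤-reflexive (sym b≡))))

critOdd≡critEven : ∀ n → n % 2 ≡ 1 → critOdd n ≡ critEven n
critOdd≡critEven n odd with halve n
... | m , inj₁ refl = contradiction (trans (sym ([m+m]%2 m)) odd) λ ()
... | m , inj₂ refl = cong (λ k → ℕtoℚ (2 ^ (suc (m + m) ∸ 2)) ℚ.- ½ ℚ.* ℕtoℚ ((m + m) choose k))
  (trans ([m+m]/2 m) (sym ([1+m+m]/2 m)))

threshold-odd : ∀ n → 1 < n → n % 2 ≡ 1 → Threshold n (critOdd n)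
threshold-odd n 1<n odd = subst (Threshold n) (sym (critOdd≡critEven n odd))
  (threshold-even n 1<n (midBinomial-parity-odd n 1<n odd))

theorem3 : ((n : ℕ) → 1 < n → (M : ℚ) →
    (n % 2 ≡ 1 → (ChooserWins (Vset n) (KM n M) ⇔ critOdd n ≤ M))
    × (n % 2 ≡ 0 → ¬ IsPowerOf2 n → (ChooserWins (Vset n) (KM n M) ⇔ critEven n ≤ M))
    × (IsPowerOf2 n → (ChooserWins (Vset n) (KM n M) ⇔ critPow2 n ≤ M)))
    × (∃[ C ] ((n : ℕ) → 1 < n →
    (n % 2 ≡ 1 → AsymBound C n (critOdd n))
    × (n % 2 ≡ 0 → ¬ IsPowerOf2 n → AsymBound C n (critEven n))
    × (IsPowerOf2 n → AsymBound C n (critPow2 n))))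
theorem3 =
  (λ n 1<n M →
      (λ odd → threshold-wins 1<n (threshold-odd n 1<n odd) M)
    , (λ even ¬pow → threshold-wins 1<n (threshold-even n 1<n (midBinomial-parity-even n 1<n even ¬pow)) M)
    , (λ pow → threshold-wins 1<n (threshold-pow2 n 1<n (midBinomial-parity-pow2 n 1<n pow)) M))
  , 1 , λ n 1<n →
      (λ odd → threshold-asymptotics 1<n (threshold-odd n 1<n odd))
    , (λ even ¬pow → threshold-asymptotics 1<n (threshold-even n 1<n (midBinomial-parity-even n 1<n even ¬pow)))
    , (λ pow → threshold-asymptotics 1<n (threshold-pow2 n 1<n (midBinomial-parity-pow2 n 1<n pow)))
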